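{- Let $a,b\ge1$ be integers, and let $TC(a,a,2b)$ be the number of lozenge tilings of the hexagon $H(a,a,2b)$ that are symmetric with respect to its symmetry axis perpendicular to the sides of length $2b$. Then $$TC(a,a,2b)=\frac{\displaystyle\prod_{j=1}^{a-1}(b+j)^{\min(j,\,a-j)}\ \prod_{j=1}^{a-2}(2b+2j+1)^{\min(j,\,a-1-j)}}{\displaystyle\prod_{j=1}^{a-1}j^{\min(j,\,a-j)}\ \prod_{j=1}^{a-2}(2j+1)^{\min(j,\,a-1-j)}},$$ where empty products equal $1$.
   Context: Work in the regular triangular lattice with unit side. $H(a,b,c)$ is the lattice hexagon with all angles $120^\circ$ and side lengths $a,b,c,a,b,c$ in cyclic order. A lozenge is a unit rhombus that is the union of two unit triangles of the lattice sharing an edge; a lozenge tiling of the hexagon is a covering of it by lozenges contained in it, without gaps or overlaps. (Such symmetric tilings correspond to transposed-complementary plane partitions.) -}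

module Defs where

open import Data.Bool.Base using (Bool; true)
open import Data.Fin.Base using (Fin)
open import Data.Integer.Base as ℤ using (ℤ; +_; -_; 0ℤ; 1ℤ)
open import Data.List.Base using (List; []; _∷_; applyUpTo)
open import Data.List.Relation.Unary.All using (All)
open import Data.List.Relation.Unary.All.Properties using (applyUpTo⁺₂)
open import Data.Nat.Base using (ℕ; suc; _+_; _*_; _∸_; _^_; _⊓_; NonZero)
open import Data.Nat.ListAction using (product)
open import Data.Nat.ListAction.Properties using (product≢0)
open import Data.Nat.Properties using (m*n≢0; m^n≢0)
open import Data.Product using (Σ; _×_; _,_; proj₁; ∃!)
open import Data.Rational.Base using (ℚ; _/_)
open import Data.Sum.Base using (_⊎_)
open import Function.Bundles using (Inverse)
open import Level using (0ℓ)
open import Relation.Binary.Bundles using (Setoid)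
import Relation.Binary.Construct.On as On
open import Relation.Binary.PropositionalEquality using (_≡_; setoid; _→-setoid_)

-- (x , y) is the lattice point x e₁ + y e₂, where e₁ and e₂ are unit vectors
-- at an angle of 60°.  The third lattice direction is e₂ - e₁.
Point : Set
Point = ℤ × ℤ

-- △ p has corners p, p + e₁, p + e₂.
-- ▽ p has corners p + e₁, p + e₂, p + e₁ + e₂.
data Triangle : Set where
  △ ▽ : Point → Triangle

corners : Triangle → List Point
corners (△ (x , y)) = (x , y) ∷ (1ℤ ℤ.+ x , y) ∷ (x , 1ℤ ℤ.+ y) ∷ []
corners (▽ (x , y)) = (1ℤ ℤ.+ x , y) ∷ (x , 1ℤ ℤ.+ y) ∷ (1ℤ ℤ.+ x , 1ℤ ℤ.+ y) ∷ []

-- The sides of △ p, named by their directions: e₁ is the side from p to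
-- p + e₁, e₂ the side from p to p + e₂, e₂-e₁ the side from p + e₁ to p + e₂.
data Side : Set where
  e₁ e₂ e₂-e₁ : Side

-- Triangles sharing an edge have opposite orientations, so a lozenge amounts
-- to a triangle △ p together with the side across which its other half lies.
record Lozenge : Set where
  constructor lozenge
  field
    base : Point
    side : Side

△-half ▽-half : Lozenge → Triangle
△-half (lozenge p _) = △ p
▽-half (lozenge (x , y) e₁)    = ▽ (x , y ℤ.- 1ℤ)
▽-half (lozenge (x , y) e₂)    = ▽ (x ℤ.- 1ℤ , y)
▽-half (lozenge (x , y) e₂-e₁) = ▽ (x , y)

_∈ˡ_ : Triangle → Lozenge → Set
t ∈ˡ l = t ≡ △-half l ⊎ t ≡ ▽-half l

-- The hexagon whose boundary, started at the origin, makes a steps along e₁,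
-- b along e₂, c along e₂ - e₁, a along - e₁, b along - e₂ and c along e₁ - e₂.
-- Its corners are (0 , 0), (a , 0), (a , b), (a - c , b + c), (- c , b + c)
-- and (- c , c).
InHexagon : (a b c : ℕ) → Point → Set
InHexagon a b c (x , y) =
  (- (+ c) ℤ.≤ x × x ℤ.≤ + a) ×
  (0ℤ ℤ.≤ y × y ℤ.≤ + (b + c)) ×
  (0ℤ ℤ.≤ x ℤ.+ y × x ℤ.+ y ℤ.≤ + (a + b))

-- The hexagon is convex, so testing corners decides containment.
_⊆H[_,_,_] : Triangle → (a b c : ℕ) → Set
t ⊆H[ a , b , c ] = All (InHexagon a b c) (corners t)

-- A tiling is a set of lozenges, given by its characteristic function; being
-- finite, every such set is decidable.
record Tiling (a b c : ℕ) : Set where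
  field
    member    : Lozenge → Bool
    contained : ∀ l → member l ≡ true →
                △-half l ⊆H[ a , b , c ] × ▽-half l ⊆H[ a , b , c ]
    covered   : ∀ t → t ⊆H[ a , b , c ] →
                ∃! _≡_ (λ l → member l ≡ true × t ∈ˡ l)

-- In the hexagon with sides a, a, c the sides of length c are parallel to
-- e₂ - e₁, one running from (0 , 0) to (- c , c), the other from (a , a) to
-- (a - c , a + c).  The reflection in the axis perpendicular to them exchanges
-- e₁ with e₂ and the two ends of each of these sides.
reflectPoint : ℕ → Point → Point
reflectPoint c (x , y) = (y ℤ.- + c , x ℤ.+ + c)

reflectSide : Side → Side
reflectSide e₁    = e₂
reflectSide e₂    = e₁
reflectSide e₂-e₁ = e₂-e₁

-- Since e₁ and e₂ are exchanged, △ p goes to △ (reflectPoint c p).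
reflect : ℕ → Lozenge → Lozenge
reflect c (lozenge p s) = lozenge (reflectPoint c p) (reflectSide s)

Symmetric : ∀ {a c} → Tiling a a c → Set
Symmetric {c = c} T = ∀ l → member (reflect c l) ≡ member l
  where open Tiling T

-- Two tilings are equal when they consist of the same lozenges.
SymmetricTilings : (a c : ℕ) → Setoid 0ℓ 0ℓ
SymmetricTilings a c =
  On.setoid {B = Σ (Tiling a a c) Symmetric} (Lozenge →-setoid Bool)
            (λ T → Tiling.member (proj₁ T))

HasCardinality : Setoid 0ℓ 0ℓ → ℕ → Set
HasCardinality S n = Inverse (setoid (Fin n)) S

-- f 1 * f 2 * ⋯ * f n
∏[1≤j≤_] : ℕ → (ℕ → ℕ) → ℕ
∏[1≤j≤ n ] f = product (applyUpTo (λ i → f (suc i)) n)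

∏-nonZero : ∀ n (f : ℕ → ℕ) → (∀ i → NonZero (f (suc i))) → NonZero (∏[1≤j≤ n ] f)
∏-nonZero n f f≢0 = product≢0 (applyUpTo⁺₂ (λ i → f (suc i)) n f≢0)

-- For j in the ranges of the products every truncated subtraction in the
-- exponents is exact, and a ∸ 2 only truncates where the product is empty.
numerator : ℕ → ℕ → ℕ
numerator a b =
  ∏[1≤j≤ a ∸ 1 ] (λ j → (b + j) ^ (j ⊓ (a ∸ j))) *
  ∏[1≤j≤ a ∸ 2 ] (λ j → (2 * b + 2 * j + 1) ^ (j ⊓ (a ∸ 1 ∸ j)))

denominator : ℕ → ℕ
denominator a =
  ∏[1≤j≤ a ∸ 1 ] (λ j → j ^ (j ⊓ (a ∸ j))) *
  ∏[1≤j≤ a ∸ 2 ] (λ j → (2 * j + 1) ^ (j ⊓ (a ∸ 1 ∸ j)))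

denominator-nonZero : ∀ a → NonZero (denominator a)
denominator-nonZero a = m*n≢0 _ _
  {{∏-nonZero (a ∸ 1) (λ j → j ^ (j ⊓ (a ∸ j)))
      (λ i → m^n≢0 (suc i) (suc i ⊓ (a ∸ suc i)))}}
  {{∏-nonZero (a ∸ 2) (λ j → (2 * j + 1) ^ (j ⊓ (a ∸ 1 ∸ j)))
      (λ i → m^n≢0 (2 * suc i + 1) (suc i ⊓ (a ∸ 1 ∸ suc i)))}}

productFormula : ℕ → ℕ → ℚ
productFormula a b = _/_ (+ numerator a b) (denominator a) {{denominator-nonZero a}}

{-# OPTIONS --safe #-}
module Submission where

-- A symmetric tiling is determined by its lozenges across the lattice lines
-- perpendicular to the axis, on one side of it; those on the axis are forced.
-- From one line to the next their positions interlace, as in a symplectic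
-- Gelfand-Tsetlin pattern, and completing the hexagon to a trapezoid by forced
-- lozenges makes the last row b, b + 1, ..., b + a - 1.  Summing a determinant
-- det (f k (p l)) over interlacing positions gives the same determinant for the
-- summatory functions of the f k.  Hence the number of patterns with last row p
-- is det (C (p l + k, 2k)), which is 1 / ∏ (2k)! times a Vandermonde determinant
-- in the numbers p (p + 1).  Its value, the product of (j - i) (2b + i + j + 1)
-- over 0 ≤ i < j < a divided by ∏ (2k)!, takes the stated form by an induction
-- reducing (a + 2, b) to (a, b + 1).

-- An odd line has an edge centred on the axis, an even line has none. Passing from an even line to
-- the next odd one keeps the number of positions; the lozenge forced across the middle edge then
-- adds a position 0 and moves the others up by one. This is what enlarges the determinant: the new
-- position carries a function whose sum is the constant 1, and alternating summation with the shift
-- of positions turns 1 = C (p, 0) into p = C (p, 1), then into C (p + 1, 2), and so on to C (p + k,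
-- 2k). Determinants are not expanded over permutations. They are elements of an exterior algebra on
-- bit words, and the sum over interlacing words commutes with exterior multiplication once each
-- function is replaced by its sum. Falling factorials stand in for binomial coefficients to keep
-- everything integral. On the geometric side a chain of words records only one half of a symmetric
-- tiling, and only the lozenges across the lines; the others are recovered as states of the
-- automaton that checks a column.

-- Sums of determinants over interlacing words

module Transfer where

  open import Data.Bool.Base using (Bool; true; false; if_then_else_)
  open import Data.Vec.Base using (Vec; []; _∷_; _∷ʳ_)
  open import Data.Nat.Base using (ℕ; zero; suc)
  open import Data.Integer.Base using (ℤ; +_; 0ℤ; 1ℤ; _+_; _*_; _-_; -_)
  open import Data.Integer.Tactic.RingSolver using (solve-∀)
  import Data.Integer.Properties as ℤₚ
  open import Function.Base using (_∘_)
  open import Relation.Binary.PropositionalEquality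

  Word : ℕ → Set
  Word = Vec Bool

  -- The part of a tiling in the column between two consecutive lattice lines
  -- perpendicular to the axis.  Coming from outside towards the axis, △ and ▽
  -- alternate.  A bit says whether the lozenge across an edge of a line (one with
  -- side e₂-e₁) is present: x for the △ with its edge on the later line, y for the
  -- ▽ that follows it, with its edge on the earlier line.  The carry is some if the last ▽ has to be
  -- matched with the next △, and fail if no tiling is possible.
  data Carry : Set where
    none some fail : Carry

  step : Carry → Bool → Bool → Carry
  step none false false = none
  step none false true  = fail
  step none true  true  = none
  step none true  false = some
  step some false true  = none
  step some false false = some
  step some true  _     = fail
  step fail _     _     = fail

  run : ∀ {m} → Carry → Word m → Word m → Carry
  run s []      []      = s
  run s (x ∷ v) (y ∷ u) = run (step s x y) v u

  accept : Carry → Bool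
  accept none = true
  accept some = false
  accept fail = false

  sumW : ∀ {m} → (Word m → ℤ) → ℤ
  sumW {zero}  Φ = Φ []
  sumW {suc m} Φ = sumW (Φ ∘ (true ∷_)) + sumW (Φ ∘ (false ∷_))

  sumW-cong : ∀ {m} {Φ Ψ : Word m → ℤ} → (∀ u → Φ u ≡ Ψ u) → sumW Φ ≡ sumW Ψ
  sumW-cong {zero}  eq = eq []
  sumW-cong {suc m} eq = cong₂ _+_ (sumW-cong (eq ∘ (true ∷_))) (sumW-cong (eq ∘ (false ∷_)))

  sumW-0 : ∀ {m} → sumW {m} (λ _ → 0ℤ) ≡ 0ℤ
  sumW-0 {zero}  = refl
  sumW-0 {suc m} = cong₂ _+_ (sumW-0 {m}) (sumW-0 {m})

  sumW-* : ∀ {m} k (Φ : Word m → ℤ) → sumW (λ u → k * Φ u) ≡ k * sumW Φ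
  sumW-* {zero}  k Φ = refl
  sumW-* {suc m} k Φ = trans (cong₂ _+_ (sumW-* k (Φ ∘ (true ∷_))) (sumW-* k (Φ ∘ (false ∷_))))
          (sym (ℤₚ.*-distribˡ-+ k (sumW (Φ ∘ (true ∷_))) (sumW (Φ ∘ (false ∷_)))))

  sumW-∷ʳ : ∀ {m} (Φ : Word (suc m) → ℤ) →
            sumW Φ ≡ sumW (λ u → Φ (u ∷ʳ true)) + sumW (λ u → Φ (u ∷ʳ false))
  sumW-∷ʳ {zero}  Φ = refl
  sumW-∷ʳ {suc m} Φ =
    trans (cong₂ _+_ (sumW-∷ʳ (Φ ∘ (true ∷_))) (sumW-∷ʳ (Φ ∘ (false ∷_))))
          (swap (part true true) (part true false) (part false true) (part false false))
    where
    part : Bool → Bool → ℤ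
    part x y = sumW (λ u → Φ (x ∷ (u ∷ʳ y)))
    swap : ∀ w x y z → (w + x) + (y + z) ≡ (w + y) + (x + z)
    swap = solve-∀

  transfer : ∀ {m} → Carry → (Word m → ℤ) → Word m → ℤ
  transfer s Φ v = sumW (λ u → if accept (run s v u) then Φ u else 0ℤ)

  transfer-fail : ∀ {m} (Φ : Word m → ℤ) v → transfer fail Φ v ≡ 0ℤ
  transfer-fail Φ []      = refl
  transfer-fail Φ (x ∷ v) = cong₂ _+_ (transfer-fail _ v) (transfer-fail _ v)

  transfer-cong : ∀ {m} s {Φ Ψ : Word m → ℤ} v → (∀ u → Φ u ≡ Ψ u) → transfer s Φ v ≡ transfer s Ψ v
  transfer-cong s v eq = sumW-cong λ u → cong (if accept (run s v u) then_else 0ℤ) (eq u)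

  if-* : ∀ (p : Bool) k x → (if p then k * x else 0ℤ) ≡ k * (if p then x else 0ℤ)
  if-* true  k x = refl
  if-* false k x = sym (ℤₚ.*-zeroʳ k)

  transfer-* : ∀ {m} s k (Φ : Word m → ℤ) v → transfer s (λ u → k * Φ u) v ≡ k * transfer s Φ v
  transfer-* s k Φ v = trans (sumW-cong λ u → if-* (accept (run s v u)) k (Φ u)) (sumW-* k (λ u → if accept (run s v u) then Φ u else 0ℤ))

  transfer-- : ∀ {m} s (Φ Ψ : Word m → ℤ) v →
               transfer s (λ u → Φ u - Ψ u) v ≡ transfer s Φ v - transfer s Ψ v
  transfer-- none Φ Ψ [] = refl
  transfer-- some Φ Ψ [] = refl
  transfer-- fail Φ Ψ [] = refl
  transfer-- s    Φ Ψ (x ∷ v) =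
    trans (cong₂ _+_ (transfer-- (step s x true) (Φ ∘ (true ∷_)) (Ψ ∘ (true ∷_)) v)
                     (transfer-- (step s x false) (Φ ∘ (false ∷_)) (Ψ ∘ (false ∷_)) v))
          (lemma (part true Φ) (part true Ψ) (part false Φ) (part false Ψ))
    where
    part : Bool → (Word _ → ℤ) → ℤ
    part y Φ = transfer (step s x y) (λ u → Φ (y ∷ u)) v
    lemma : ∀ a b c d → (a - b) + (c - d) ≡ (a + c) - (b + d)
    lemma = solve-∀

  -- A word stands for the positions of its true bits, the position of a bit being
  -- the number of bits after it.  Then create f is the exterior product with f, so
  -- that iterated on the vacuum it gives the determinants det (f k (p l)).
  create : ∀ {m} → (ℕ → ℤ) → (Word m → ℤ) → Word m → ℤ
  create         f Φ []          = 0ℤ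
  create         f Φ (false ∷ v) = create f (Φ ∘ (false ∷_)) v
  create {suc m} f Φ (true ∷ v)  = f m * Φ (false ∷ v) - create f (Φ ∘ (true ∷_)) v

  vacuum : ∀ {m} → Word m → ℤ
  vacuum []          = 1ℤ
  vacuum (true ∷ v)  = 0ℤ
  vacuum (false ∷ v) = vacuum v

  create-cong : ∀ {m} {f g : ℕ → ℤ} {Φ Ψ : Word m → ℤ} v →
                (∀ i → f i ≡ g i) → (∀ u → Φ u ≡ Ψ u) → create f Φ v ≡ create g Ψ v
  create-cong []          p q = refl
  create-cong (false ∷ v) p q = create-cong v p (q ∘ (false ∷_))
  create-cong (true ∷ v)  p q =
    cong₂ _-_ (cong₂ _*_ (p _) (q _)) (create-cong v p (q ∘ (true ∷_)))

  create-+ : ∀ {m} f k (Φ Ψ : Word m → ℤ) v →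
             create f (λ u → Φ u + k * Ψ u) v ≡ create f Φ v + k * create f Ψ v
  create-+ f k Φ Ψ []          = sym (trans (ℤₚ.+-identityˡ _) (ℤₚ.*-zeroʳ k))
  create-+ f k Φ Ψ (false ∷ v) = create-+ f k _ _ v
  create-+ {suc m} f k Φ Ψ (true ∷ v)  =
    trans (cong (λ z → f m * (Φ (false ∷ v) + k * Ψ (false ∷ v)) - z) (create-+ f k (Φ ∘ (true ∷_)) (Ψ ∘ (true ∷_)) v))
          (lemma (f m) k (Φ (false ∷ v)) (Ψ (false ∷ v)) (create f (Φ ∘ (true ∷_)) v) (create f (Ψ ∘ (true ∷_)) v))
    where
    lemma : ∀ a k x y z w → a * (x + k * y) - (z + k * w) ≡ (a * x - z) + k * (a * y - w)
    lemma = solve-∀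

  create-+ˡ : ∀ {m} f g k (Φ : Word m → ℤ) v →
              create (λ i → f i + k * g i) Φ v ≡ create f Φ v + k * create g Φ v
  create-+ˡ f g k Φ []          = sym (trans (ℤₚ.+-identityˡ _) (ℤₚ.*-zeroʳ k))
  create-+ˡ f g k Φ (false ∷ v) = create-+ˡ f g k _ v
  create-+ˡ {suc m} f g k Φ (true ∷ v)  =
    trans (cong (λ z → (f m + k * g m) * Φ (false ∷ v) - z) (create-+ˡ f g k (Φ ∘ (true ∷_)) v))
          (lemma (f m) (g m) k (Φ (false ∷ v)) (create f (Φ ∘ (true ∷_)) v) (create g (Φ ∘ (true ∷_)) v))
    where
    lemma : ∀ a b k x z w → (a + k * b) * x - (z + k * w) ≡ (a * x - z) + k * (b * x - w)
    lemma = solve-∀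

  create-0 : ∀ {m} f (v : Word m) → create f (λ _ → 0ℤ) v ≡ 0ℤ
  create-0 f []          = refl
  create-0 f (false ∷ v) = create-0 f v
  create-0 {suc m} f (true ∷ v) = cong₂ _-_ (ℤₚ.*-zeroʳ (f m)) (create-0 f v)

  create-* : ∀ {m} f k (Φ : Word m → ℤ) v → create f (λ u → k * Φ u) v ≡ k * create f Φ v
  create-* f k Φ v =
    trans (create-cong v (λ _ → refl) (λ u → sym (ℤₚ.+-identityˡ _)))
    (trans (create-+ f k (λ _ → 0ℤ) Φ v)
    (trans (cong (_+ k * create f Φ v) (create-0 f v)) (ℤₚ.+-identityˡ _)))

  -- That is f ∧ f ∧ Φ = 0. For determinants: adding to a function a multiple of the one created
  -- just before changes nothing, which later permits a change of basis.
  create-create : ∀ {m} f (Φ : Word m → ℤ) v → create f (create f Φ) v ≡ 0ℤ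
  create-create f Φ []          = refl
  create-create f Φ (false ∷ v) = create-create f _ v
  create-create {suc m} f Φ (true ∷ v) = begin
    f m * create f Φ₀ v - create f (λ u → f m * Φ₀ u - create f Φ₁ u) v
      ≡⟨ cong (λ z → f m * create f Φ₀ v - z) (create-cong v (λ _ → refl) (λ u → flip (f m) (Φ₀ u) (create f Φ₁ u))) ⟩
    f m * create f Φ₀ v - create f (λ u → - 1ℤ * create f Φ₁ u + f m * Φ₀ u) v
      ≡⟨ cong (λ z → f m * create f Φ₀ v - z) (create-+ f (f m) _ _ v) ⟩
    f m * create f Φ₀ v - (create f (λ u → - 1ℤ * create f Φ₁ u) v + f m * create f Φ₀ v)
      ≡⟨ cong (λ z → f m * create f Φ₀ v - (z + f m * create f Φ₀ v))
           (trans (create-* f (- 1ℤ) _ v) (cong (- 1ℤ *_) (create-create f Φ₁ v))) ⟩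
    f m * create f Φ₀ v - (- 1ℤ * 0ℤ + f m * create f Φ₀ v)
      ≡⟨ cancel (f m * create f Φ₀ v) ⟩
    0ℤ ∎
    where
    open ≡-Reasoning
    Φ₀ Φ₁ : Word m → ℤ
    Φ₀ = Φ ∘ (false ∷_)
    Φ₁ = Φ ∘ (true ∷_)
    flip : ∀ a x y → a * x - y ≡ - 1ℤ * y + a * x
    flip = solve-∀
    cancel : ∀ x → x - (- 1ℤ * 0ℤ + x) ≡ 0ℤ
    cancel = solve-∀

  transfer-none-false : ∀ {m} (Φ : Word (suc m) → ℤ) v →
                        transfer none Φ (false ∷ v) ≡ transfer none (Φ ∘ (false ∷_)) v
  transfer-none-false Φ v = 
    trans (cong (_+ transfer none (Φ ∘ (false ∷_)) v) (transfer-fail (Φ ∘ (true ∷_)) v)) (ℤₚ.+-identityˡ _)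

  -- Words v and u that can be consecutive interlace, so transfer sums over one
  -- variable per interval between positions of v.  In the determinants this turns
  -- φ into its summatory function Q.  For some, the positions of v are preceded by
  -- one just above all others.
  module _ (φ Q : ℕ → ℤ) (Q₀ : Q 0 ≡ 0ℤ) (ΔQ : ∀ n → Q (suc n) ≡ Q n + φ n) where

    private
      P : ℕ → ℤ
      P n = Q (suc n)

    mutual
      transfer-none : ∀ {m} (Φ : Word m → ℤ) v →
                      transfer none (create φ Φ) v ≡ create P (transfer none Φ) v
      transfer-none Φ [] = refl
      transfer-none Φ (false ∷ v) = begin
        transfer fail _ v + transfer none (create φ Φ₀) v
          ≡⟨ cong₂ _+_ (transfer-fail _ v) (transfer-none Φ₀ v) ⟩
        0ℤ + create P (transfer none Φ₀) v
          ≡⟨ ℤₚ.+-identityˡ _ ⟩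
        create P (transfer none Φ₀) v
          ≡⟨ create-cong v (λ _ → refl) (λ u → sym (transfer-none-false Φ u)) ⟩
        create P (λ u → transfer none Φ (false ∷ u)) v ∎
        where open ≡-Reasoning
              Φ₀ = Φ ∘ (false ∷_)
      transfer-none Φ (true ∷ v) = transfer-branch Φ v

      transfer-some : ∀ {m} (Φ : Word m → ℤ) v →
                      transfer some (create φ Φ) v ≡ Q m * transfer none Φ v - create P (transfer some Φ) v
      -- No position is left for the pending lozenge, and `Q 0` is the empty sum.
      transfer-some Φ [] = sym (cong (λ q → q * Φ [] - 0ℤ) Q₀)
      transfer-some Φ (false ∷ v) = transfer-branch Φ v
      -- A lozenge is still pending, so nothing is accepted. On the right the pending position
      -- contributes `Q (suc m)`, which is `P m`, the value at the leading bit; the terms cancel as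
      -- in a determinant with two equal columns.
      transfer-some {suc m} Φ (true ∷ v) = begin
        transfer fail _ v + transfer fail _ v
          ≡⟨ cong₂ _+_ (transfer-fail _ v) (transfer-fail _ v) ⟩
        0ℤ
          ≡⟨ sym (cancel (P m * transfer none Φ (true ∷ v))) ⟩
        P m * transfer none Φ (true ∷ v) - (P m * transfer none Φ (true ∷ v) - 0ℤ)
          ≡⟨ cong (λ z → P m * transfer none Φ (true ∷ v) - (P m * transfer none Φ (true ∷ v) - z))
               (sym (trans (create-cong v (λ _ → refl) (λ u →
                              cong₂ _+_ (transfer-fail (Φ ∘ (true ∷_)) u) (transfer-fail (Φ ∘ (false ∷_)) u)))
                           (create-0 P v))) ⟩
        P m * transfer none Φ (true ∷ v) - create P (transfer some Φ) (true ∷ v) ∎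
        where open ≡-Reasoning
              cancel : ∀ x → x - (x - 0ℤ) ≡ 0ℤ
              cancel = solve-∀

      -- Carry `none` before a true bit and carry `some` before a false bit continue alike: a true
      -- bit in the earlier word leads to `none`, a false one to `some`. The term with `φ m` puts a
      -- position at m, the term with `Q m` puts it lower; together they give `P m`.
      transfer-branch : ∀ {m} (Φ : Word (suc m) → ℤ) v →
        transfer none (λ u → create φ Φ (true ∷ u)) v + transfer some (λ u → create φ Φ (false ∷ u)) v
          ≡ P m * transfer none Φ (false ∷ v)
            - create P (λ u → transfer none (Φ ∘ (true ∷_)) u + transfer some (Φ ∘ (false ∷_)) u) v
      transfer-branch {m} Φ v = begin
        transfer none (λ u → φ m * Φ₀ u - create φ Φ₁ u) v + transfer some (create φ Φ₀) v
          ≡⟨ cong₂ _+_ (trans (transfer-- none _ _ v)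
                              (cong₂ _-_ (transfer-* none (φ m) Φ₀ v) (transfer-none Φ₁ v)))
                       (transfer-some Φ₀ v) ⟩
        (φ m * A₀ - create P (transfer none Φ₁) v) + (Q m * A₀ - create P (transfer some Φ₀) v)
          ≡⟨ lemma (φ m) (Q m) A₀ _ _ ⟩
        (Q m + φ m) * A₀ - (create P (transfer none Φ₁) v + 1ℤ * create P (transfer some Φ₀) v)
          ≡⟨ cong₂ _-_ (cong₂ _*_ (sym (ΔQ m)) (sym (transfer-none-false Φ v)))
               (trans (sym (create-+ P 1ℤ _ _ v))
                      (create-cong v (λ _ → refl) (λ u → cong (λ z → transfer none Φ₁ u + z) (ℤₚ.*-identityˡ _)))) ⟩
        P m * transfer none Φ (false ∷ v) - create P (λ u → transfer none Φ₁ u + transfer some Φ₀ u) v ∎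
        where open ≡-Reasoning
              Φ₀ = Φ ∘ (false ∷_)
              Φ₁ = Φ ∘ (true ∷_)
              A₀ = transfer none Φ₀ v
              lemma : ∀ p q a x y → (p * a - x) + (q * a - y) ≡ (q + p) * a - (x + 1ℤ * y)
              lemma = solve-∀

-- Counting chains by determinants of falling factorials

module Counting where

  open import Data.Bool.Base using (Bool; true; false; if_then_else_)
  open import Data.Vec.Base using ([]; _∷_; _∷ʳ_)
  open import Data.Nat.Base as ℕ using (ℕ; zero; suc)
  import Data.Nat.Properties as ℕₚ
  open import Data.Integer.Base using (ℤ; +_; 0ℤ; 1ℤ; _+_; _*_; _-_; -_)
  open import Data.Integer.Tactic.RingSolver using (solve-∀)
  import Data.Integer.Properties as ℤₚ
  open import Function.Base using (_∘_; const)
  open import Relation.Binary.PropositionalEquality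
  open Transfer

  create-*ˡ : ∀ {m} k f (Φ : Word m → ℤ) v → create (λ i → k * f i) Φ v ≡ k * create f Φ v
  create-*ˡ k f Φ []          = sym (ℤₚ.*-zeroʳ k)
  create-*ˡ k f Φ (false ∷ v) = create-*ˡ k f (Φ ∘ (false ∷_)) v
  create-*ˡ {suc m} k f Φ (true ∷ v) =
    trans (cong (λ z → (k * f m) * Φ (false ∷ v) - z) (create-*ˡ k f (Φ ∘ (true ∷_)) v))
          (lemma k (f m) (Φ (false ∷ v)) (create f (Φ ∘ (true ∷_)) v))
    where
    lemma : ∀ k a x y → (k * a) * x - k * y ≡ k * (a * x - y)
    lemma = solve-∀

  -- The factor `c` lets both `φ` and `Q` be falling factorials, since the difference of one is an
  -- integer multiple of the next lower one. No division occurs.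
  transfer-create : ∀ {m} c (φ Q : ℕ → ℤ) → Q 0 ≡ 0ℤ → (∀ n → Q (suc n) ≡ Q n + c * φ n) →
                    (Φ : Word m → ℤ) → ∀ v →
                    c * transfer none (create φ Φ) v ≡ create (Q ∘ suc) (transfer none Φ) v
  transfer-create c φ Q Q₀ ΔQ Φ v = begin
    c * transfer none (create φ Φ) v              ≡⟨ transfer-* none c (create φ Φ) v ⟨
    transfer none (λ u → c * create φ Φ u) v      ≡⟨ transfer-cong none v (λ u → sym (create-*ˡ c φ Φ u)) ⟩
    transfer none (create (λ n → c * φ n) Φ) v    ≡⟨ transfer-none (λ n → c * φ n) Q Q₀ ΔQ Φ v ⟩
    create (Q ∘ suc) (transfer none Φ) v          ∎
    where open ≡-Reasoning

  transfer-some-vacuum : ∀ {m} (v : Word m) → transfer some vacuum v ≡ 0ℤ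
  transfer-none-0 : ∀ {m} (v : Word m) → transfer none (λ _ → 0ℤ) v ≡ 0ℤ
  transfer-none-0 v = transfer-* none 0ℤ (λ _ → 0ℤ) v
  transfer-some-vacuum []          = refl
  transfer-some-vacuum (true ∷ v)  = cong₂ _+_ (transfer-fail _ v) (transfer-fail _ v)
  transfer-some-vacuum (false ∷ v) = cong₂ _+_ (transfer-none-0 v) (transfer-some-vacuum v)

  transfer-vacuum : ∀ {m} (v : Word m) → transfer none vacuum v ≡ vacuum v
  transfer-vacuum []          = refl
  transfer-vacuum (true ∷ v)  = cong₂ _+_ (transfer-none-0 v) (transfer-some-vacuum v)
  transfer-vacuum (false ∷ v) = trans (transfer-none-false vacuum v) (transfer-vacuum v)

  -- The bit appended on an odd line is that of the middle edge, which is true.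
  appended : ∀ {m} → (Word m → ℤ) → Word (suc m) → ℤ
  appended {zero}  Φ (x ∷ []) = if x then Φ [] else 0ℤ
  appended {suc m} Φ (x ∷ v)  = appended (Φ ∘ (x ∷_)) v

  appended-true : ∀ {m} (Φ : Word m → ℤ) u → appended Φ (u ∷ʳ true) ≡ Φ u
  appended-true Φ []      = refl
  appended-true Φ (x ∷ u) = appended-true (Φ ∘ (x ∷_)) u

  appended-false : ∀ {m} (Φ : Word m → ℤ) u → appended Φ (u ∷ʳ false) ≡ 0ℤ
  appended-false Φ []      = refl
  appended-false Φ (x ∷ u) = appended-false (Φ ∘ (x ∷_)) u

  appended-cong : ∀ {m} {Φ Ψ : Word m → ℤ} v → (∀ u → Φ u ≡ Ψ u) → appended Φ v ≡ appended Ψ v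
  appended-cong {zero}  (x ∷ []) eq = cong (if x then_else 0ℤ) (eq [])
  appended-cong {suc m} (x ∷ v)  eq = appended-cong v (eq ∘ (x ∷_))

  appended-- : ∀ {m} k (Φ Ψ : Word m → ℤ) v →
               appended (λ u → k * Φ u - Ψ u) v ≡ k * appended Φ v - appended Ψ v
  appended-- {zero}  k Φ Ψ (true ∷ [])  = refl
  appended-- {zero}  k Φ Ψ (false ∷ []) = sym (cong (_- 0ℤ) (ℤₚ.*-zeroʳ k))
  appended-- {suc m} k Φ Ψ (x ∷ v)      = appended-- k (Φ ∘ (x ∷_)) (Ψ ∘ (x ∷_)) v

  appended-0 : ∀ {m} (v : Word (suc m)) → appended (λ _ → 0ℤ) v ≡ 0ℤ
  appended-0 {zero}  (true ∷ [])  = refl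
  appended-0 {zero}  (false ∷ []) = refl
  appended-0 {suc m} (x ∷ v)      = appended-0 v

  -- The appended bit takes position 0, so every other position moves up by one. In the base case
  -- both sides vanish, `appended Φ` being zero where the last bit is false.
  create-appended : ∀ {m} f (Φ : Word m → ℤ) v →
                    appended (create (f ∘ suc) Φ) v ≡ create f (appended Φ) v
  create-appended {zero}  f Φ (true ∷ [])  = sym (cong (_- 0ℤ) (ℤₚ.*-zeroʳ (f 0)))
  create-appended {zero}  f Φ (false ∷ []) = refl
  create-appended {suc m} f Φ (false ∷ v)  = create-appended f (Φ ∘ (false ∷_)) v
  create-appended {suc m} f Φ (true ∷ v)   =
    trans (appended-- (f (suc m)) (Φ ∘ (false ∷_)) (create (f ∘ suc) (Φ ∘ (true ∷_))) v)
          (cong (λ z → f (suc m) * appended (Φ ∘ (false ∷_)) v - z) (create-appended f (Φ ∘ (true ∷_)) v))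

  atZero : ℕ → ℤ
  atZero zero    = 1ℤ
  atZero (suc n) = 0ℤ

  -- Adjoining the middle edge is exterior multiplication by the indicator of position 0. Its sum up
  -- to any position is 1, which is `evenF 0`.
  appended-vacuum : ∀ {m} (v : Word (suc m)) → appended vacuum v ≡ create atZero vacuum v
  appended-vacuum {zero}  (true ∷ [])  = refl
  appended-vacuum {zero}  (false ∷ []) = refl
  appended-vacuum {suc m} (true ∷ v)   = trans (appended-0 v) (sym (cong (λ z → 0ℤ - z) (create-0 atZero v)))
  appended-vacuum {suc m} (false ∷ v)  = appended-vacuum v

  sumW-appended : ∀ {m} (Φ : Word m → ℤ) v →
    sumW (λ u → if accept (run none v (u ∷ʳ true)) then Φ u else 0ℤ) ≡ transfer none (appended Φ) v
  sumW-appended {m} Φ v = sym (begin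
    transfer none (appended Φ) v
      ≡⟨ sumW-∷ʳ (λ û → if accept (run none v û) then appended Φ û else 0ℤ) ⟩
    sumW (λ u → if accept (run none v (u ∷ʳ true)) then appended Φ (u ∷ʳ true) else 0ℤ)
      + sumW (λ u → if accept (run none v (u ∷ʳ false)) then appended Φ (u ∷ʳ false) else 0ℤ)
      ≡⟨ cong₂ _+_
           (sumW-cong λ u → cong (if accept (run none v (u ∷ʳ true)) then_else 0ℤ) (appended-true Φ u))
           (trans (sumW-cong λ u → trans (cong (if accept (run none v (u ∷ʳ false)) then_else 0ℤ) (appended-false Φ u))
                                         (if-0 (accept (run none v (u ∷ʳ false)))))
                  (sumW-0 {m})) ⟩
    sumW (λ u → if accept (run none v (u ∷ʳ true)) then Φ u else 0ℤ) + 0ℤ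
      ≡⟨ ℤₚ.+-identityʳ _ ⟩
    sumW (λ u → if accept (run none v (u ∷ʳ true)) then Φ u else 0ℤ) ∎)
    where
    open ≡-Reasoning
    if-0 : ∀ (p : Bool) → (if p then 0ℤ else 0ℤ) ≡ 0ℤ
    if-0 true  = refl
    if-0 false = refl

  falling : ℤ → ℕ → ℤ
  falling x zero    = 1ℤ
  falling x (suc r) = falling x r * (x - + r)

  falling-suc : ∀ x r → falling (1ℤ + x) (suc r) ≡ (1ℤ + x) * falling x r
  falling-suc x zero    = lemma x
    where
    lemma : ∀ x → 1ℤ * (1ℤ + x - 0ℤ) ≡ (1ℤ + x) * 1ℤ
    lemma = solve-∀
  falling-suc x (suc r) =
    trans (cong (_* (1ℤ + x - + suc r)) (falling-suc x r)) (lemma x (+ r) (falling x r))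
    where
    lemma : ∀ x r f → ((1ℤ + x) * f) * (1ℤ + x - (1ℤ + r)) ≡ (1ℤ + x) * (f * (x - r))
    lemma = solve-∀

  -- Pascal's rule for C (x + 1, r + 1), multiplied by (r + 1)!.
  falling-Δ : ∀ x r → falling (1ℤ + x) (suc r) ≡ falling x (suc r) + (+ suc r) * falling x r
  falling-Δ x r = trans (falling-suc x r) (lemma x (+ r) (falling x r))
    where
    lemma : ∀ x r f → (1ℤ + x) * f ≡ f * (x - r) + (1ℤ + r) * f
    lemma = solve-∀

  falling-zero : ∀ j k → falling (+ j) (suc (k ℕ.+ j)) ≡ 0ℤ
  falling-zero j zero    = trans (cong (falling (+ j) j *_) (ℤₚ.+-inverseʳ (+ j))) (ℤₚ.*-zeroʳ (falling (+ j) j))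
  falling-zero j (suc k) = cong (_* (+ j - + suc (k ℕ.+ j))) (falling-zero j k)

  -- (2n)! C(p+n, 2n), a monic polynomial of degree n in p (p + 1); and
  -- (2n+1)! C(p+n, 2n+1).  Each is, up to a factor, the sum of the other kind.
  evenF : ℕ → ℕ → ℤ
  evenF n p = falling (+ p + + n) (n ℕ.+ n)

  oddF : ℕ → ℕ → ℤ
  oddF n p = falling (+ p + + n) (suc (n ℕ.+ n))

  evenD : ∀ {m} → ℕ → Word m → ℤ
  evenD zero    = vacuum
  evenD (suc n) = create (evenF n) (evenD n)

  -- The argument is shifted because `transfer` sums up to and including a position. Appending the
  -- middle edge, which renumbers the positions, removes the shift.
  oddD : ∀ {m} → ℕ → Word m → ℤ
  oddD zero    = vacuum
  oddD (suc n) = create (oddF n ∘ suc) (oddD n)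

  prod : (ℕ → ℕ) → ℕ → ℕ
  prod f zero    = 1
  prod f (suc n) = prod f n ℕ.* f n

  odds evens : ℕ → ℕ
  odds  = prod (λ j → suc (j ℕ.+ j))
  evens = prod (λ j → suc (suc (j ℕ.+ j)))

  pos-* : ∀ m n x → + (m ℕ.* n) * x ≡ + m * (+ n * x)
  pos-* m n x = trans (cong (_* x) (ℤₚ.pos-* m n)) (ℤₚ.*-assoc (+ m) (+ n) x)

  transfer-evenD : ∀ {m} n (v : Word m) → + odds n * transfer none (evenD n) v ≡ oddD n v
  transfer-evenD zero    v = trans (ℤₚ.*-identityˡ _) (transfer-vacuum v)
  transfer-evenD (suc n) v = begin
    + (odds n ℕ.* suc (n ℕ.+ n)) * transfer none (create (evenF n) (evenD n)) v
      ≡⟨ pos-* (odds n) (suc (n ℕ.+ n)) (transfer none (create (evenF n) (evenD n)) v) ⟩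
    + odds n * (+ suc (n ℕ.+ n) * transfer none (create (evenF n) (evenD n)) v)
      ≡⟨ cong (+ odds n *_) (transfer-create (+ suc (n ℕ.+ n)) (evenF n) (oddF n)
           (falling-zero n n) (λ p → falling-Δ (+ p + + n) (n ℕ.+ n)) (evenD n) v) ⟩
    + odds n * create (oddF n ∘ suc) (transfer none (evenD n)) v
      ≡⟨ create-* (oddF n ∘ suc) (+ odds n) (transfer none (evenD n)) v ⟨
    create (oddF n ∘ suc) (λ u → + odds n * transfer none (evenD n) u) v
      ≡⟨ create-cong v (λ _ → refl) (transfer-evenD n) ⟩
    oddD (suc n) v ∎
    where open ≡-Reasoning

  -- Here the determinant grows: each `oddF k` becomes `evenF (k + 1)` at the cost of a factor 2k +
  -- 2, and the middle edge supplies `evenF 0`.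
  transfer-oddD : ∀ {m} n (v : Word (suc m)) → + evens n * transfer none (appended (oddD n)) v ≡ evenD (suc n) v
  transfer-oddD zero v = begin
    1ℤ * transfer none (appended vacuum) v
      ≡⟨ cong (1ℤ *_) (transfer-cong none v appended-vacuum) ⟩
    1ℤ * transfer none (create atZero vacuum) v
      ≡⟨ transfer-create 1ℤ atZero Q refl ΔQ vacuum v ⟩
    create (const 1ℤ) (transfer none vacuum) v
      ≡⟨ create-cong v (λ _ → refl) transfer-vacuum ⟩
    create (const 1ℤ) vacuum v ∎
    where
    open ≡-Reasoning
    Q : ℕ → ℤ
    Q zero    = 0ℤ
    Q (suc n) = 1ℤ
    ΔQ : ∀ n → Q (suc n) ≡ Q n + 1ℤ * atZero n
    ΔQ zero    = refl
    ΔQ (suc n) = refl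
  transfer-oddD (suc n) v = begin
    + (evens n ℕ.* c) * transfer none (appended (oddD (suc n))) v
      ≡⟨ pos-* (evens n) c (transfer none (appended (oddD (suc n))) v) ⟩
    + evens n * (+ c * transfer none (appended (oddD (suc n))) v)
      ≡⟨ cong (λ z → + evens n * (+ c * z)) (transfer-cong none v (create-appended (oddF n) (oddD n))) ⟩
    + evens n * (+ c * transfer none (create (oddF n) (appended (oddD n))) v)
      ≡⟨ cong (+ evens n *_) (transfer-create (+ c) (oddF n) Q (falling-zero n (suc n))
           (λ p → falling-Δ (+ p + + n) (suc (n ℕ.+ n))) (appended (oddD n)) v) ⟩
    + evens n * create (Q ∘ suc) (transfer none (appended (oddD n))) v
      ≡⟨ create-* (Q ∘ suc) (+ evens n) (transfer none (appended (oddD n))) v ⟨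
    create (Q ∘ suc) (λ u → + evens n * transfer none (appended (oddD n)) u) v
      ≡⟨ create-cong v Q-suc (transfer-oddD n) ⟩
    evenD (suc (suc n)) v ∎
    where
    open ≡-Reasoning
    c : ℕ
    c = suc (suc (n ℕ.+ n))
    Q : ℕ → ℤ
    Q p = falling (+ p + + n) c
    Q-suc : ∀ p → Q (suc p) ≡ evenF (suc n) p
    Q-suc p = cong₂ falling (sym (cong +_ (ℕₚ.+-suc p n))) (sym (ℕₚ.+-suc (suc n) n))

  sumℕ : ∀ {m} → (Word m → ℕ) → ℕ
  sumℕ {zero}  Φ = Φ []
  sumℕ {suc m} Φ = sumℕ (Φ ∘ (true ∷_)) ℕ.+ sumℕ (Φ ∘ (false ∷_))

  noneTrue : ∀ {m} → Word m → Bool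
  noneTrue []          = true
  noneTrue (true ∷ v)  = false
  noneTrue (false ∷ v) = noneTrue v

  count : ∀ b n → Word (n ℕ.+ b) → ℕ
  count b zero    v = if noneTrue v then 1 else 0
  count b (suc n) v =
    sumℕ λ u → if accept (run none v (u ∷ʳ true))
      then (sumℕ λ u′ → if accept (run none u u′) then count b n u′ else 0) else 0

  pos-sumℕ : ∀ {m} (Φ : Word m → ℕ) → + sumℕ Φ ≡ sumW (λ u → + Φ u)
  pos-sumℕ {zero}  Φ = refl
  pos-sumℕ {suc m} Φ = cong₂ _+_ (pos-sumℕ (Φ ∘ (true ∷_))) (pos-sumℕ (Φ ∘ (false ∷_)))

  pos-if : ∀ (p : Bool) n → + (if p then n else 0) ≡ (if p then + n else 0ℤ)
  pos-if true  n = refl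
  pos-if false n = refl

  pos-sumℕ-if : ∀ {m} (p : Word m → Bool) (Φ : Word m → ℕ) →
    + sumℕ (λ u → if p u then Φ u else 0) ≡ sumW (λ u → if p u then + Φ u else 0ℤ)
  pos-sumℕ-if p Φ = 
    trans (pos-sumℕ (λ u → if p u then Φ u else 0)) (sumW-cong λ u → pos-if (p u) (Φ u))

  pos-noneTrue : ∀ {m} (v : Word m) → + (if noneTrue v then 1 else 0) ≡ vacuum v
  pos-noneTrue []          = refl
  pos-noneTrue (true ∷ v)  = refl
  pos-noneTrue (false ∷ v) = pos-noneTrue v

  -- By `odds*evens` this is the product of (2k)! over k < n, the factor by which determinants of
  -- falling factorials exceed those of binomial coefficients.
  scale : ℕ → ℕ
  scale = prod (λ n → odds n ℕ.* evens n)

  appended-* : ∀ {m} k (Φ : Word m → ℤ) v → appended (λ u → k * Φ u) v ≡ k * appended Φ v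
  appended-* {zero}  k Φ (true ∷ [])  = refl
  appended-* {zero}  k Φ (false ∷ []) = sym (ℤₚ.*-zeroʳ k)
  appended-* {suc m} k Φ (x ∷ v)      = appended-* k (Φ ∘ (x ∷_)) v

  transfer-appended-* : ∀ {m} k (Φ : Word m → ℤ) v →
    transfer none (appended (λ u → k * Φ u)) v ≡ k * transfer none (appended Φ) v
  transfer-appended-* k Φ v =
    trans (transfer-cong none v (appended-* k Φ)) (transfer-* none k (appended Φ) v)

  scale-count : ∀ b n v → + scale n * + count b n v ≡ evenD n v
  scale-count b zero    v = trans (ℤₚ.*-identityˡ _) (pos-noneTrue v)
  scale-count b (suc n) v = begin
    + (scale n ℕ.* (odds n ℕ.* evens n)) * + count b (suc n) v
      ≡⟨ cong (+ (scale n ℕ.* (odds n ℕ.* evens n)) *_) pos-count ⟩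
    + (scale n ℕ.* (odds n ℕ.* evens n)) * T (T₀ counted)
      ≡⟨ cong (_* T (T₀ counted)) (trans (ℤₚ.pos-* (scale n) (odds n ℕ.* evens n)) (cong (+ scale n *_) (ℤₚ.pos-* (odds n) (evens n)))) ⟩
    (+ scale n * (+ odds n * + evens n)) * T (T₀ counted)
      ≡⟨ rearrange (+ scale n) (+ odds n) (+ evens n) (T (T₀ counted)) ⟩
    + evens n * (+ odds n * (+ scale n * T (T₀ counted)))
      ≡⟨ cong (λ z → + evens n * (+ odds n * z)) (sym (transfer-appended-* (+ scale n) (T₀ counted) v)) ⟩
    + evens n * (+ odds n * T (λ u → + scale n * T₀ counted u))
      ≡⟨ cong (λ z → + evens n * (+ odds n * z)) (transfer-cong none v λ û → appended-cong û λ u →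
           trans (sym (transfer-* none (+ scale n) counted u)) (transfer-cong none u (scale-count b n))) ⟩
    + evens n * (+ odds n * T (T₀ (evenD n)))
      ≡⟨ cong (+ evens n *_) (sym (transfer-appended-* (+ odds n) (T₀ (evenD n)) v)) ⟩
    + evens n * T (λ u → + odds n * T₀ (evenD n) u)
      ≡⟨ cong (+ evens n *_) (transfer-cong none v λ û → appended-cong û (transfer-evenD n)) ⟩
    + evens n * T (oddD n)
      ≡⟨ transfer-oddD n v ⟩
    evenD (suc n) v ∎
    where
    open ≡-Reasoning
    counted : Word (n ℕ.+ b) → ℤ
    counted u = + count b n u
    T₀ : (Word (n ℕ.+ b) → ℤ) → Word (n ℕ.+ b) → ℤ
    T₀ = transfer none
    T : (Word (n ℕ.+ b) → ℤ) → ℤ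
    T Φ = transfer none (appended Φ) v
    rearrange : ∀ s o e x → (s * (o * e)) * x ≡ e * (o * (s * x))
    rearrange = solve-∀
    pos-count : + count b (suc n) v ≡ T (T₀ counted)
    pos-count = begin
      + count b (suc n) v
        ≡⟨ pos-sumℕ-if (λ u → accept (run none v (u ∷ʳ true))) _ ⟩
      sumW (λ u → if accept (run none v (u ∷ʳ true))
        then + sumℕ (λ u′ → if accept (run none u u′) then count b n u′ else 0) else 0ℤ)
        ≡⟨ sumW-cong (λ u → cong (if accept (run none v (u ∷ʳ true)) then_else 0ℤ)
             (pos-sumℕ-if (λ u′ → accept (run none u u′)) (count b n))) ⟩
      sumW (λ u → if accept (run none v (u ∷ʳ true)) then T₀ counted u else 0ℤ)
        ≡⟨ sumW-appended (T₀ counted) v ⟩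
      T (T₀ counted) ∎

-- Evaluation as a Vandermonde determinant

module Vandermonde where

  open import Data.Bool.Base using (true; false)
  open import Data.Vec.Base using ([]; _∷_; replicate)
  open import Data.Nat.Base as ℕ using (ℕ; zero; suc)
  import Data.Nat.Properties as ℕₚ
  open import Data.Integer.Base using (ℤ; +_; 0ℤ; 1ℤ; _+_; _*_; _-_; -_)
  open import Data.Integer.Tactic.RingSolver using (solve-∀)
  import Data.Integer.Properties as ℤₚ
  open import Function.Base using (_∘_; const)
  open import Relation.Binary.PropositionalEquality
  open Transfer
  open Counting

  quad : ℕ → ℤ
  quad p = + p * (1ℤ + + p)

  -- The two outermost factors pair up: (p + n + 1) (p - n) = p (p + 1) - n (n + 1). Hence `evenF n`
  -- is the Newton polynomial in `quad p` with nodes `quad 0`, ..., `quad (n - 1)`.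
  evenF-suc : ∀ n p → evenF (suc n) p ≡ evenF n p * (quad p - quad n)
  evenF-suc n p = begin
    falling (+ p + + suc n) (suc n ℕ.+ suc n)
      ≡⟨ cong₂ falling (cong +_ (ℕₚ.+-suc p n)) (ℕₚ.+-suc (suc n) n) ⟩
    falling (1ℤ + x) (suc (suc (n ℕ.+ n)))
      ≡⟨ falling-suc x (suc (n ℕ.+ n)) ⟩
    (1ℤ + x) * (falling x (n ℕ.+ n) * (x - (+ n + + n)))
      ≡⟨ lemma (+ p) (+ n) (falling x (n ℕ.+ n)) ⟩
    falling x (n ℕ.+ n) * (quad p - quad n) ∎
    where
    open ≡-Reasoning
    x : ℤ
    x = + p + + n
    lemma : ∀ p n f → (1ℤ + (p + n)) * (f * ((p + n) - (n + n))) ≡ f * (p * (1ℤ + p) - n * (1ℤ + n))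
    lemma = solve-∀

  -- The Newton basis with y put in front of the nodes quad 0, quad 1, ...
  newton : ℤ → ℕ → ℕ → ℤ
  newton y zero    p = 1ℤ
  newton y (suc n) p = (quad p - y) * evenF n p

  newtonD : ∀ {m} → ℤ → ℕ → Word m → ℤ
  newtonD y zero    = vacuum
  newtonD y (suc n) = create (newton y n) (newtonD y n)

  -- Moving the node `y` to the front changes each basis function by a multiple of the preceding
  -- `evenF`, which the determinant already contains; `create-create` removes it.
  newtonD≡evenD : ∀ {m} y n (v : Word m) → newtonD y n v ≡ evenD n v
  newtonD≡evenD y zero          v = refl
  newtonD≡evenD y (suc zero)    v = refl
  newtonD≡evenD y (suc (suc n)) v = begin
    create (newton y (suc n)) (newtonD y (suc n)) v
      ≡⟨ create-cong v expand (newtonD≡evenD y (suc n)) ⟩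
    create (λ p → evenF (suc n) p + (quad n - y) * evenF n p) (evenD (suc n)) v
      ≡⟨ create-+ˡ (evenF (suc n)) (evenF n) (quad n - y) (evenD (suc n)) v ⟩
    evenD (suc (suc n)) v + (quad n - y) * create (evenF n) (create (evenF n) (evenD n)) v
      ≡⟨ cong (λ z → evenD (suc (suc n)) v + (quad n - y) * z) (create-create (evenF n) (evenD n) v) ⟩
    evenD (suc (suc n)) v + (quad n - y) * 0ℤ
      ≡⟨ lemma (evenD (suc (suc n)) v) (quad n - y) ⟩
    evenD (suc (suc n)) v ∎
    where
    open ≡-Reasoning
    lemma : ∀ x k → x + k * 0ℤ ≡ x
    lemma = solve-∀
    regroup : ∀ q y k f → (q - y) * f ≡ f * (q - k) + (k - y) * f
    regroup = solve-∀
    expand : ∀ p → newton y (suc n) p ≡ evenF (suc n) p + (quad n - y) * evenF n p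
    expand p = trans (regroup (quad p) y (quad n) (evenF n p))
                     (cong (_+ (quad n - y) * evenF n p) (sym (evenF-suc n p)))

  weight : ∀ {m} → ℤ → Word m → ℤ
  weight         y []          = 1ℤ
  weight {suc m} y (true ∷ v)  = (y - quad m) * weight y v
  weight         y (false ∷ v) = weight y v

  weight-vacuum : ∀ {m} y (v : Word m) → weight y v * vacuum v ≡ vacuum v
  weight-vacuum y []          = refl
  weight-vacuum y (true ∷ v)  = ℤₚ.*-zeroʳ (weight y (true ∷ v))
  weight-vacuum y (false ∷ v) = weight-vacuum y v

  -- Each column of the determinant belongs to one position p, and its common factor `y - quad p`
  -- comes out.
  create-weight : ∀ {m} y f (Φ : Word m → ℤ) v →
    create (λ p → (y - quad p) * f p) (λ u → weight y u * Φ u) v ≡ weight y v * create f Φ v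
  create-weight y f Φ []          = refl
  create-weight y f Φ (false ∷ v) = create-weight y f (Φ ∘ (false ∷_)) v
  create-weight {suc m} y f Φ (true ∷ v) = begin
    (d * f m) * (weight y v * Φ₀) - create g (λ u → (d * weight y u) * Φ (true ∷ u)) v
      ≡⟨ cong (λ z → (d * f m) * (weight y v * Φ₀) - z)
           (trans (create-cong v (λ _ → refl) (λ u → ℤₚ.*-assoc d (weight y u) (Φ (true ∷ u))))
           (trans (create-* g d (λ u → weight y u * Φ (true ∷ u)) v)
                  (cong (d *_) (create-weight y f (Φ ∘ (true ∷_)) v)))) ⟩
    (d * f m) * (weight y v * Φ₀) - d * (weight y v * create f (Φ ∘ (true ∷_)) v)
      ≡⟨ lemma d (f m) (weight y v) Φ₀ (create f (Φ ∘ (true ∷_)) v) ⟩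
    (d * weight y v) * (f m * Φ₀ - create f (Φ ∘ (true ∷_)) v) ∎
    where
    open ≡-Reasoning
    d Φ₀ : ℤ
    d = y - quad m
    Φ₀ = Φ (false ∷ v)
    g : ℕ → ℤ
    g p = (y - quad p) * f p
    lemma : ∀ d f w x z → (d * f) * (w * x) - d * (w * z) ≡ (d * w) * (f * x - z)
    lemma = solve-∀

  -- With `y` the value of `quad` at the leading position, every Newton function but the constant
  -- vanishes there, so a single cofactor survives. Its rows have the factor `quad p - y`, and each
  -- sign in passing to `y - quad p` cancels the sign `create` produces when it moves past the
  -- leading bit.
  newtonD-true : ∀ {m} n (v : Word m) →
                 newtonD (quad m) (suc n) (true ∷ v) ≡ weight (quad m) v * evenD n v
  newtonD-true {m} zero v = begin
    1ℤ * vacuum v - create (const 1ℤ) (λ _ → 0ℤ) v  ≡⟨ cong (λ z → 1ℤ * vacuum v - z) (create-0 _ v) ⟩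
    1ℤ * vacuum v - 0ℤ                              ≡⟨ lemma (vacuum v) ⟩
    vacuum v                                        ≡⟨ weight-vacuum (quad m) v ⟨
    weight (quad m) v * vacuum v                    ∎
    where
    open ≡-Reasoning
    lemma : ∀ x → 1ℤ * x - 0ℤ ≡ x
    lemma = solve-∀
  newtonD-true {m} (suc n) v = begin
    ((y - y) * evenF n m) * newtonD y (suc n) (false ∷ v)
      - create (newton y (suc n)) (λ u → newtonD y (suc n) (true ∷ u)) v
      ≡⟨ cong (λ z → ((y - y) * evenF n m) * newtonD y (suc n) (false ∷ v) - z)
           (create-cong v (λ p → flip (quad p) y (evenF n p)) (newtonD-true n)) ⟩
    ((y - y) * evenF n m) * newtonD y (suc n) (false ∷ v)
      - create (λ p → - 1ℤ * ((y - quad p) * evenF n p)) (λ u → weight y u * evenD n u) v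
      ≡⟨ cong (λ z → ((y - y) * evenF n m) * newtonD y (suc n) (false ∷ v) - z)
           (trans (create-*ˡ (- 1ℤ) (λ p → (y - quad p) * evenF n p) (λ u → weight y u * evenD n u) v)
                  (cong (- 1ℤ *_) (create-weight y (evenF n) (evenD n) v))) ⟩
    ((y - y) * evenF n m) * newtonD y (suc n) (false ∷ v) - - 1ℤ * (weight y v * evenD (suc n) v)
      ≡⟨ cancel y (evenF n m) (newtonD y (suc n) (false ∷ v)) (weight y v * evenD (suc n) v) ⟩
    weight y v * evenD (suc n) v ∎
    where
    open ≡-Reasoning
    y : ℤ
    y = quad m
    flip : ∀ q y f → (q - y) * f ≡ - 1ℤ * ((y - q) * f)
    flip = solve-∀
    cancel : ∀ y f x z → ((y - y) * f) * x - - 1ℤ * z ≡ z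
    cancel = solve-∀

  evenD-true : ∀ {m} n (v : Word m) → evenD (suc n) (true ∷ v) ≡ weight (quad m) v * evenD n v
  evenD-true {m} n v = trans (sym (newtonD≡evenD (quad m) (suc n) (true ∷ v))) (newtonD-true n v)

  topTrue : ∀ b n → Word (n ℕ.+ b)
  topTrue b zero    = replicate b false
  topTrue b (suc n) = true ∷ topTrue b n

  -- For i ≤ n this is `quad (n + b) - quad (i + b)`, factored.
  gap : ℕ → ℕ → ℕ → ℕ
  gap b n i = (n ℕ.∸ i) ℕ.* suc (n ℕ.+ i ℕ.+ (b ℕ.+ b))

  pos-gap : ∀ b d i → + gap b (d ℕ.+ i) i ≡ quad (d ℕ.+ i ℕ.+ b) - quad (i ℕ.+ b)
  pos-gap b d i = begin
    + ((d ℕ.+ i ℕ.∸ i) ℕ.* suc (d ℕ.+ i ℕ.+ i ℕ.+ (b ℕ.+ b)))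
      ≡⟨ cong (λ k → + (k ℕ.* suc (d ℕ.+ i ℕ.+ i ℕ.+ (b ℕ.+ b)))) (ℕₚ.m+n∸n≡m d i) ⟩
    + (d ℕ.* suc (d ℕ.+ i ℕ.+ i ℕ.+ (b ℕ.+ b)))
      ≡⟨ ℤₚ.pos-* d _ ⟩
    + d * (1ℤ + (+ d + + i + + i + (+ b + + b)))
      ≡⟨ lemma (+ d) (+ i) (+ b) ⟩
    quad (d ℕ.+ i ℕ.+ b) - quad (i ℕ.+ b) ∎
    where
    open ≡-Reasoning
    lemma : ∀ d i b → d * (1ℤ + (d + i + i + (b + b)))
                      ≡ (d + i + b) * (1ℤ + (d + i + b)) - (i + b) * (1ℤ + (i + b))
    lemma = solve-∀

  -- `d` witnesses i ≤ n, which keeps the truncated subtraction in `gap` exact throughout the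
  -- induction.
  weight-topTrue : ∀ b n d i → d ℕ.+ i ≡ n → weight (quad (n ℕ.+ b)) (topTrue b i) ≡ + prod (gap b n) i
  weight-topTrue b n d zero    eq = weight-false b
    where
    weight-false : ∀ m → weight (quad (n ℕ.+ b)) (replicate m false) ≡ 1ℤ
    weight-false zero    = refl
    weight-false (suc m) = weight-false m
  weight-topTrue b n d (suc i) eq = begin
    (quad (n ℕ.+ b) - quad (i ℕ.+ b)) * weight (quad (n ℕ.+ b)) (topTrue b i)
      ≡⟨ cong₂ _*_ (subst (λ k → quad (k ℕ.+ b) - quad (i ℕ.+ b) ≡ + gap b k i) eq′ (sym (pos-gap b (suc d) i)))
           (weight-topTrue b n (suc d) i eq′) ⟩
    + gap b n i * + prod (gap b n) i
      ≡⟨ ℤₚ.*-comm (+ gap b n i) (+ prod (gap b n) i) ⟩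
    + prod (gap b n) i * + gap b n i
      ≡⟨ ℤₚ.pos-* (prod (gap b n) i) (gap b n i) ⟨
    + prod (gap b n) (suc i) ∎
    where
    open ≡-Reasoning
    eq′ : suc d ℕ.+ i ≡ n
    eq′ = trans (sym (ℕₚ.+-suc d i)) eq

  evenD-topTrue : ∀ b n → evenD n (topTrue b n) ≡ + prod (λ k → prod (gap b k) k) n
  evenD-topTrue b zero = vacuum-false b
    where
    vacuum-false : ∀ m → vacuum (replicate m false) ≡ 1ℤ
    vacuum-false zero    = refl
    vacuum-false (suc m) = vacuum-false m
  evenD-topTrue b (suc n) = begin
    evenD (suc n) (true ∷ topTrue b n)
      ≡⟨ evenD-true n (topTrue b n) ⟩
    weight (quad (n ℕ.+ b)) (topTrue b n) * evenD n (topTrue b n)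
      ≡⟨ cong₂ _*_ (weight-topTrue b n 0 n refl) (evenD-topTrue b n) ⟩
    + prod (gap b n) n * + prod (λ k → prod (gap b k) k) n
      ≡⟨ ℤₚ.*-comm (+ prod (gap b n) n) (+ prod (λ k → prod (gap b k) k) n) ⟩
    + prod (λ k → prod (gap b k) k) n * + prod (gap b n) n
      ≡⟨ ℤₚ.pos-* (prod (λ k → prod (gap b k) k) n) (prod (gap b n) n) ⟨
    + prod (λ k → prod (gap b k) k) (suc n) ∎
    where open ≡-Reasoning

  scale-count-topTrue : ∀ b n → scale n ℕ.* count b n (topTrue b n) ≡ prod (λ k → prod (gap b k) k) n
  scale-count-topTrue b n = ℤₚ.+-injective (begin
    + (scale n ℕ.* count b n (topTrue b n))     ≡⟨ ℤₚ.pos-* (scale n) (count b n (topTrue b n)) ⟩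
    + scale n * + count b n (topTrue b n)       ≡⟨ scale-count b n (topTrue b n) ⟩
    evenD n (topTrue b n)                       ≡⟨ evenD-topTrue b n ⟩
    + prod (λ k → prod (gap b k) k) n           ∎)
    where open ≡-Reasoning

-- From the Vandermonde product to the stated quotient

module ProductFormula where

  open import Defs
  open import Data.Nat.Base
  open import Data.Nat.Properties
  open import Data.Nat.Tactic.RingSolver using (solve-∀)
  open import Function.Base using (_∘_)
  open import Relation.Binary.PropositionalEquality
  import Data.Integer.Base as ℤ
  import Data.Rational.Base as ℚ
  import Data.Integer.Properties as ℤₚ
  import Data.Rational.Unnormalised.Base as ℚᵘ
  import Data.Rational.Properties as ℚₚ
  open Counting using (prod; odds; evens; scale; count)
  open Vandermonde using (gap; topTrue; scale-count-topTrue)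

  prod-cong : ∀ {f g : ℕ → ℕ} n → (∀ i → i < n → f i ≡ g i) → prod f n ≡ prod g n
  prod-cong zero    eq = refl
  prod-cong (suc n) eq = cong₂ _*_ (prod-cong n (λ i i<n → eq i (m<n⇒m<1+n i<n))) (eq n ≤-refl)

  interchange : ∀ a b c d → (a * b) * (c * d) ≡ (a * c) * (b * d)
  interchange = solve-∀

  prod-* : ∀ f g n → prod (λ i → f i * g i) n ≡ prod f n * prod g n
  prod-* f g zero    = refl
  prod-* f g (suc n) = trans (cong (_* (f n * g n)) (prod-* f g n)) (interchange (prod f n) (prod g n) (f n) (g n))

  prod-shift : ∀ f n → prod f (suc n) ≡ f 0 * prod (f ∘ suc) n
  prod-shift f zero    = *-comm 1 (f 0)
  prod-shift f (suc n) = trans (cong (_* f (suc n)) (prod-shift f n)) (*-assoc (f 0) _ _)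

  prod-+ : ∀ f m n → prod f (m + n) ≡ prod f m * prod (λ i → f (m + i)) n
  prod-+ f m zero    = trans (cong (prod f) (+-identityʳ m)) (sym (*-identityʳ _))
  prod-+ f m (suc n) = trans (cong (prod f) (+-suc m n))
    (trans (cong (_* f (m + n)) (prod-+ f m n)) (*-assoc (prod f m) _ _))

  prod-double : ∀ f n → prod f (n + n) ≡ prod (λ j → f (j + j)) n * prod (λ j → f (suc (j + j))) n
  prod-double f zero    = refl
  prod-double f (suc n) = begin
    prod f (n + suc n) * f (n + suc n)             ≡⟨ cong (λ k → prod f k * f k) (+-suc n n) ⟩
    prod f (n + n) * f (n + n) * f (suc (n + n))   ≡⟨ cong (λ z → z * f (n + n) * f (suc (n + n))) (prod-double f n) ⟩
    (A * B) * f (n + n) * f (suc (n + n))          ≡⟨ lemma A B (f (n + n)) (f (suc (n + n))) ⟩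
    (A * f (n + n)) * (B * f (suc (n + n)))        ∎
    where
    open ≡-Reasoning
    A B : ℕ
    A = prod (λ j → f (j + j)) n
    B = prod (λ j → f (suc (j + j))) n
    lemma : ∀ a b c d → (a * b) * c * d ≡ (a * c) * (b * d)
    lemma = solve-∀

  prod-nonZero : ∀ f n → (∀ i → i < n → NonZero (f i)) → NonZero (prod f n)
  prod-nonZero f zero    nz = _
  prod-nonZero f (suc n) nz =
    m*n≢0 _ _ {{prod-nonZero f n (λ i i<n → nz i (m<n⇒m<1+n i<n))}} {{nz n ≤-refl}}

  ∏≡prod : ∀ n f → ∏[1≤j≤ n ] f ≡ prod (f ∘ suc) n
  ∏≡prod zero    f = refl
  ∏≡prod (suc n) f = trans (cong (f 1 *_) (∏≡prod n (f ∘ suc))) (sym (prod-shift (f ∘ suc) n))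

  -- The factor with index n ∸ 1 has exponent 0; it is kept because the recursion
  -- in steps of two then needs no truncated subtraction.
  pyramid : (ℕ → ℕ) → ℕ → ℕ
  pyramid f n = prod (λ i → f (suc i) ^ (suc i ⊓ (n ∸ suc i))) n

  last-exponent : ∀ n → suc n ⊓ (n ∸ n) ≡ 0
  last-exponent n = trans (cong (suc n ⊓_) (n∸n≡0 n)) (⊓-zeroʳ (suc n))

  ∏≡pyramid : ∀ f n → ∏[1≤j≤ n ∸ 1 ] (λ j → f j ^ (j ⊓ (n ∸ j))) ≡ pyramid f n
  ∏≡pyramid f zero    = refl
  ∏≡pyramid f (suc n) = begin
    ∏[1≤j≤ n ] (λ j → f j ^ (j ⊓ (suc n ∸ j)))
      ≡⟨ ∏≡prod n (λ j → f j ^ (j ⊓ (suc n ∸ j))) ⟩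
    A
      ≡⟨ *-identityʳ A ⟨
    A * 1
      ≡⟨ cong (λ k → A * f (suc n) ^ k) (last-exponent n) ⟨
    A * f (suc n) ^ (suc n ⊓ (n ∸ n)) ∎
    where
    open ≡-Reasoning
    A : ℕ
    A = prod (λ i → f (suc i) ^ (suc i ⊓ (n ∸ i))) n

  -- For 1 ≤ j ≤ n + 1 one has min (j, n + 2 - j) = 1 + min (j - 1, n - (j - 1)). Taking one copy of
  -- each factor away leaves the smaller pyramid, moved by one place.
  pyramid-suc² : ∀ f n → pyramid f (suc (suc n)) ≡ prod (f ∘ suc) (suc n) * pyramid (f ∘ suc) n
  pyramid-suc² f n = begin
    pyramid f (suc (suc n))
      ≡⟨ cong (λ k → prod (λ i → f (suc i) ^ (suc i ⊓ (suc n ∸ i))) (suc n) * f (suc (suc n)) ^ k) (last-exponent (suc n)) ⟩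
    prod (λ i → f (suc i) ^ (suc i ⊓ (suc n ∸ i))) (suc n) * 1
      ≡⟨ *-identityʳ _ ⟩
    prod (λ i → f (suc i) ^ (suc i ⊓ (suc n ∸ i))) (suc n)
      ≡⟨ prod-cong (suc n) (λ i i<1+n → cong (λ k → f (suc i) ^ (suc i ⊓ k)) (+-∸-assoc 1 (≤-pred i<1+n))) ⟩
    prod (λ i → f (suc i) * f (suc i) ^ (i ⊓ (n ∸ i))) (suc n)
      ≡⟨ prod-* (f ∘ suc) (λ i → f (suc i) ^ (i ⊓ (n ∸ i))) (suc n) ⟩
    prod (f ∘ suc) (suc n) * prod (λ i → f (suc i) ^ (i ⊓ (n ∸ i))) (suc n)
      ≡⟨ cong (prod (f ∘ suc) (suc n) *_) (trans (prod-shift _ n) (*-identityˡ _)) ⟩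
    prod (f ∘ suc) (suc n) * pyramid (f ∘ suc) n ∎
    where open ≡-Reasoning

  pyramid-cong : ∀ {f g : ℕ → ℕ} → (∀ i → f i ≡ g i) → ∀ n → pyramid f n ≡ pyramid g n
  pyramid-cong eq n = prod-cong n (λ i _ → cong (_^ (suc i ⊓ (n ∸ suc i))) (eq (suc i)))

  pyramid-suc : ∀ f n → pyramid f (suc n) ≡ prod (f ∘ suc) n * pyramid (f ∘ suc) (n ∸ 1)
  pyramid-suc f zero    = refl
  pyramid-suc f (suc n) = pyramid-suc² f n

  oddFactor : ℕ → ℕ → ℕ
  oddFactor b j = 2 * b + 2 * j + 1

  numerator≡ : ∀ a b → numerator a b ≡ pyramid (b +_) a * pyramid (oddFactor b) (a ∸ 1)
  numerator≡ a b = cong₂ _*_ (∏≡pyramid (b +_) a)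
    (trans (cong (λ n → ∏[1≤j≤ n ] (λ j → oddFactor b j ^ (j ⊓ (a ∸ 1 ∸ j)))) (sym (∸-+-assoc a 1 1)))
           (∏≡pyramid (oddFactor b) (a ∸ 1)))

  -- Moving either pyramid by one place amounts to raising `b` by one, in `b + j` as well as in
  -- `2 * b + 2 * j + 1`.
  numerator-suc² : ∀ a b → numerator (suc (suc a)) b ≡
    prod (λ i → b + suc i) (suc a) * prod (λ i → oddFactor b (suc i)) a * numerator a (suc b)
  numerator-suc² a b = begin
    numerator (suc (suc a)) b
      ≡⟨ numerator≡ (suc (suc a)) b ⟩
    pyramid (b +_) (suc (suc a)) * pyramid (oddFactor b) (suc a)
      ≡⟨ cong₂ _*_ (pyramid-suc² (b +_) a) (pyramid-suc (oddFactor b) a) ⟩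
    (A * pyramid (λ j → b + suc j) a) * (B * pyramid (λ j → oddFactor b (suc j)) (a ∸ 1))
      ≡⟨ interchange A _ B _ ⟩
    A * B * (pyramid (λ j → b + suc j) a * pyramid (λ j → oddFactor b (suc j)) (a ∸ 1))
      ≡⟨ cong (A * B *_) (cong₂ _*_ (pyramid-cong (+-suc b) a) (pyramid-cong (lemma b) (a ∸ 1))) ⟩
    A * B * (pyramid (suc b +_) a * pyramid (oddFactor (suc b)) (a ∸ 1))
      ≡⟨ cong (A * B *_) (numerator≡ a (suc b)) ⟨
    A * B * numerator a (suc b) ∎
    where
    open ≡-Reasoning
    A B : ℕ
    A = prod (λ i → b + suc i) (suc a)
    B = prod (λ i → oddFactor b (suc i)) a
    lemma : ∀ b j → 2 * b + 2 * (1 + j) + 1 ≡ 2 * (1 + b) + 2 * j + 1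
    lemma = solve-∀

  -- The factors of row k of the Vandermonde product that remain beside the differences k - i.
  rise : ℕ → ℕ → ℕ
  rise b k = prod (λ i → suc (k + i + (b + b))) k

  rise-suc : ∀ b k → rise b (suc k) ≡ suc (suc (k + (b + b))) * rise (suc b) k
  rise-suc b k = trans (prod-shift (λ i → suc (suc k + i + (b + b))) k)
    (cong₂ _*_ (cong (λ z → suc (suc (z + (b + b)))) (+-identityʳ k))
               (prod-cong k (λ i _ → lemma k i b)))
    where
    lemma : ∀ k i b → 1 + (1 + k + (1 + i) + (b + b)) ≡ 1 + (k + i + ((1 + b) + (1 + b)))
    lemma = solve-∀

  -- Splitting the first factor off every nonempty row gives `s 0`, ..., `s a`; what is left of the
  -- last row continues this run up to `s (a + a)`. The terms of even index are 2 (b + j + 1), those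
  -- of odd index are the odd factors.
  prod-rise-suc² : ∀ a b → prod (rise b) (suc (suc a)) ≡
    prod (λ _ → 2) (suc a) *
    (prod (λ i → b + suc i) (suc a) * prod (λ i → oddFactor b (suc i)) a * prod (rise (suc b)) a)
  prod-rise-suc² a b = begin
    prod (rise b) (suc (suc a))
      ≡⟨ trans (prod-shift (rise b) (suc a)) (*-identityˡ _) ⟩
    prod (rise b ∘ suc) (suc a)
      ≡⟨ trans (prod-cong (suc a) (λ k _ → rise-suc b k)) (prod-* s (rise (suc b)) (suc a)) ⟩
    prod s (suc a) * (prod (rise (suc b)) a * rise (suc b) a)
      ≡⟨ cong (λ z → prod s (suc a) * (prod (rise (suc b)) a * z)) (prod-cong a (λ i _ → lemma₁ a i b)) ⟩
    prod s (suc a) * (prod (rise (suc b)) a * prod (λ i → s (suc a + i)) a)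
      ≡⟨ lemma₂ (prod s (suc a)) (prod (rise (suc b)) a) (prod (λ i → s (suc a + i)) a) ⟩
    (prod s (suc a) * prod (λ i → s (suc a + i)) a) * prod (rise (suc b)) a
      ≡⟨ cong (_* prod (rise (suc b)) a) (sym (prod-+ s (suc a) a)) ⟩
    (prod s (a + a) * s (a + a)) * prod (rise (suc b)) a
      ≡⟨ cong (λ z → (z * s (a + a)) * prod (rise (suc b)) a) (prod-double s a) ⟩
    ((prod (λ j → s (j + j)) a * prod (λ j → s (suc (j + j))) a) * s (a + a)) * prod (rise (suc b)) a
      ≡⟨ lemma₃ (prod (λ j → s (j + j)) a) _ (s (a + a)) _ ⟩
    prod (λ j → s (j + j)) (suc a) * (prod (λ j → s (suc (j + j))) a * prod (rise (suc b)) a)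
      ≡⟨ cong₂ (λ y z → y * (z * prod (rise (suc b)) a))
           (trans (prod-cong (suc a) (λ j _ → lemma₄ j b)) (prod-* (λ _ → 2) (λ j → b + suc j) (suc a)))
           (prod-cong a (λ j _ → lemma₅ j b)) ⟩
    (prod (λ _ → 2) (suc a) * prod (λ i → b + suc i) (suc a)) *
      (prod (λ i → oddFactor b (suc i)) a * prod (rise (suc b)) a)
      ≡⟨ lemma₆ (prod (λ _ → 2) (suc a)) (prod (λ i → b + suc i) (suc a)) _ _ ⟩
    _ ∎
    where
    open ≡-Reasoning
    s : ℕ → ℕ
    s k = suc (suc (k + (b + b)))
    lemma₁ : ∀ a i b → 1 + (a + i + ((1 + b) + (1 + b))) ≡ 2 + ((1 + a + i) + (b + b))
    lemma₁ = solve-∀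
    lemma₂ : ∀ x y z → x * (y * z) ≡ (x * z) * y
    lemma₂ = solve-∀
    lemma₃ : ∀ x y z w → ((x * y) * z) * w ≡ (x * z) * (y * w)
    lemma₃ = solve-∀
    lemma₄ : ∀ j b → 2 + ((j + j) + (b + b)) ≡ 2 * (b + (1 + j))
    lemma₄ = solve-∀
    lemma₅ : ∀ j b → 2 + ((1 + (j + j)) + (b + b)) ≡ 2 * b + 2 * (1 + j) + 1
    lemma₅ = solve-∀
    lemma₆ : ∀ x y z w → (x * y) * (z * w) ≡ x * (y * z * w)
    lemma₆ = solve-∀

  -- The factors 2 from the terms of even index, collected over the recursion. Being independent of
  -- `b`, they cancel against the case b = 0.
  powersOfTwo : ℕ → ℕ
  powersOfTwo zero          = 1
  powersOfTwo (suc zero)    = 1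
  powersOfTwo (suc (suc a)) = prod (λ _ → 2) (suc a) * powersOfTwo a

  powersOfTwo-nonZero : ∀ a → NonZero (powersOfTwo a)
  powersOfTwo-nonZero zero          = _
  powersOfTwo-nonZero (suc zero)    = _
  powersOfTwo-nonZero (suc (suc a)) =
    m*n≢0 _ _ {{prod-nonZero (λ _ → 2) (suc a) _}} {{powersOfTwo-nonZero a}}

  prod-rise : ∀ a b → prod (rise b) a ≡ powersOfTwo a * numerator a b
  prod-rise zero          b = refl
  prod-rise (suc zero)    b = refl
  prod-rise (suc (suc a)) b = begin
    prod (rise b) (suc (suc a))
      ≡⟨ prod-rise-suc² a b ⟩
    t * (M * prod (rise (suc b)) a)
      ≡⟨ cong (λ z → t * (M * z)) (prod-rise a (suc b)) ⟩
    t * (M * (powersOfTwo a * numerator a (suc b)))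
      ≡⟨ lemma t M (powersOfTwo a) (numerator a (suc b)) ⟩
    (t * powersOfTwo a) * (M * numerator a (suc b))
      ≡⟨ cong ((t * powersOfTwo a) *_) (numerator-suc² a b) ⟨
    powersOfTwo (suc (suc a)) * numerator (suc (suc a)) b ∎
    where
    open ≡-Reasoning
    t M : ℕ
    t = prod (λ _ → 2) (suc a)
    M = prod (λ i → b + suc i) (suc a) * prod (λ i → oddFactor b (suc i)) a
    lemma : ∀ t m p n → t * (m * (p * n)) ≡ (t * p) * (m * n)
    lemma = solve-∀

  prod-descending : ∀ k → prod (λ i → k ∸ i) k ≡ k !
  prod-descending zero    = refl
  prod-descending (suc k) = trans (prod-shift (λ i → suc k ∸ i) k) (cong (suc k *_) (prod-descending k))

  !-prod : ∀ m n → m ! * prod (λ i → suc (m + i)) n ≡ (m + n) !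
  !-prod m zero    = trans (*-identityʳ _) (cong _! (sym (+-identityʳ m)))
  !-prod m (suc n) = begin
    m ! * (prod (λ i → suc (m + i)) n * suc (m + n))   ≡⟨ *-assoc (m !) _ _ ⟨
    m ! * prod (λ i → suc (m + i)) n * suc (m + n)     ≡⟨ cong (_* suc (m + n)) (!-prod m n) ⟩
    (m + n) ! * suc (m + n)                            ≡⟨ *-comm ((m + n) !) _ ⟩
    suc (m + n) !                                      ≡⟨ cong _! (+-suc m n) ⟨
    (m + suc n) !                                      ∎
    where open ≡-Reasoning

  odds*evens : ∀ k → odds k * evens k ≡ (k + k) !
  odds*evens k = trans (sym (prod-double suc k)) (trans (sym (*-identityˡ _)) (!-prod 0 (k + k)))

  prod-gap : ∀ b k → prod (gap b k) k ≡ k ! * rise b k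
  prod-gap b k = trans (prod-* (λ i → k ∸ i) (λ i → suc (k + i + (b + b))) k)
                       (cong (_* rise b k) (prod-descending k))

  prod-prod-gap : ∀ b n → prod (λ k → prod (gap b k) k) n ≡ prod _! n * prod (rise b) n
  prod-prod-gap b n = trans (prod-cong n (λ k _ → prod-gap b k)) (prod-* _! (rise b) n)

  -- Since (2k)! = k! (k + 1) ... (2k), the normalising factor is the Vandermonde product itself at
  -- b = 0; compare `prod-prod-gap`.
  scale≡ : ∀ n → scale n ≡ prod _! n * prod (rise 0) n
  scale≡ n = trans (prod-cong n (λ k _ → trans (odds*evens k) (trans (sym (!-prod k k))
               (cong (k ! *_) (prod-cong k (λ i _ → cong suc (sym (+-identityʳ (k + i)))))))))
             (prod-* _! (rise 0) n)

  count*denominator : ∀ a b → count b a (topTrue b a) * denominator a ≡ numerator a b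
  count*denominator a b = *-cancelˡ-≡ _ _ (p * t) {{m*n≢0 p t {{p≢0}} {{powersOfTwo-nonZero a}}}} (begin
    p * t * (C * denominator a)          ≡⟨ lemma p t C (denominator a) ⟩
    -- `denominator a` is `numerator a 0` by computation, so one evaluation serves both sides of the
    -- quotient.
    p * (t * numerator a 0) * C          ≡⟨ cong (λ z → p * z * C) (prod-rise a 0) ⟨
    p * prod (rise 0) a * C              ≡⟨ cong (_* C) (scale≡ a) ⟨
    scale a * C                          ≡⟨ scale-count-topTrue b a ⟩
    prod (λ k → prod (gap b k) k) a      ≡⟨ prod-prod-gap b a ⟩
    p * prod (rise b) a                  ≡⟨ cong (p *_) (prod-rise a b) ⟩
    p * (t * numerator a b)              ≡⟨ *-assoc p t _ ⟨
    p * t * numerator a b                ∎)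
    where
    open ≡-Reasoning
    p t C : ℕ
    p = prod _! a
    t = powersOfTwo a
    C = count b a (topTrue b a)
    p≢0 : NonZero p
    p≢0 = prod-nonZero _! a (λ i _ → i !≢0)
    lemma : ∀ p t c d → p * t * (c * d) ≡ p * (t * d) * c
    lemma = solve-∀

  /1≡/ : ∀ m n d .{{_ : NonZero d}} → m * d ≡ n → ℤ.+ m ℚ./ 1 ≡ ℤ.+ n ℚ./ d
  /1≡/ m n (suc d) eq = ℚₚ.fromℚᵘ-cong {ℚᵘ.mkℚᵘ (ℤ.+ m) 0} {ℚᵘ.mkℚᵘ (ℤ.+ n) d}
    (ℚᵘ.*≡* (trans (sym (ℤₚ.pos-* m (suc d))) (trans (cong ℤ.+_ eq) (sym (ℤₚ.*-identityʳ (ℤ.+ n))))))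

  count≡productFormula : ∀ a b → ℤ.+ count b a (topTrue b a) ℚ./ 1 ≡ productFormula a b
  count≡productFormula a b =
    /1≡/ (count b a (topTrue b a)) (numerator a b) (denominator a) {{denominator-nonZero a}} (count*denominator a b)

-- Chains of words, their number and their bits

module Chains where

  open import Data.Bool.Base using (Bool; true; false; if_then_else_; T)
  open import Data.Bool.Properties using (T-irrelevant; T-≡)
  open import Data.Fin.Base using (Fin)
  open import Data.Fin.Properties using (+↔⊎; 0↔⊥; 1↔⊤)
  open import Data.Vec.Base using ([]; _∷_; _∷ʳ_)
  open import Data.Nat.Base
  open import Data.Nat.Properties
  open import Data.Product using (Σ; _×_; _,_; proj₁; proj₂)
  open import Data.Sum.Base using (_⊎_; inj₁; inj₂)
  open import Data.Sum.Function.Propositional using (_⊎-↔_)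
  open import Data.Unit.Base using (tt)
  open import Data.Empty using (⊥-elim)
  open import Relation.Nullary
  open import Function.Base using (_∘_)
  open import Function.Bundles using (_↔_; mk↔ₛ′; Equivalence)
  open import Function.Construct.Composition using (_↔-∘_)
  open import Function.Construct.Symmetry using (↔-sym)
  open import Relation.Binary.PropositionalEquality
  open Transfer
  open Counting

  -- The words of lines 2n, 2n ∸ 1, …, 0, each restricted to one side of the axis
  -- and read towards it.  On odd lines the bit of the middle edge, which symmetry
  -- forces to be true, is appended where the line is the earlier one of a column
  -- and left out otherwise.
  data Chain (b : ℕ) : ∀ n → Word (n + b) → Set where
    base : ∀ {v} → T (noneTrue v) → Chain b zero v
    link : ∀ {n v} u → T (accept (run none v (u ∷ʳ true))) →
           ∀ u′ → T (accept (run none u u′)) → Chain b n u′ → Chain b (suc n) v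

  Σ-Word↔ : ∀ {m} {Y : Word m → Set} {Φ : Word m → ℕ} →
            (∀ u → Y u ↔ Fin (Φ u)) → Σ (Word m) Y ↔ Fin (sumℕ Φ)
  Σ-Word↔ {zero}  {Y} Y↔ =
    Y↔ [] ↔-∘ mk↔ₛ′ (λ { ([] , y) → y }) ([] ,_) (λ _ → refl) (λ { ([] , y) → refl })
  Σ-Word↔ {suc m} {Y} Y↔ =
    ↔-sym +↔⊎ ↔-∘ ((Σ-Word↔ (Y↔ ∘ (true ∷_)) ⊎-↔ Σ-Word↔ (Y↔ ∘ (false ∷_))) ↔-∘ mk↔ₛ′ to from to∘from from∘to)
    where
    Heads : Set
    Heads = Σ (Word m) (Y ∘ (true ∷_)) ⊎ Σ (Word m) (Y ∘ (false ∷_))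
    to : Σ (Word (suc m)) Y → Heads
    to (true ∷ u , y)  = inj₁ (u , y)
    to (false ∷ u , y) = inj₂ (u , y)
    from : Heads → Σ (Word (suc m)) Y
    from (inj₁ (u , y)) = true ∷ u , y
    from (inj₂ (u , y)) = false ∷ u , y
    to∘from : ∀ z → to (from z) ≡ z
    to∘from (inj₁ _) = refl
    to∘from (inj₂ _) = refl
    from∘to : ∀ z → from (to z) ≡ z
    from∘to (true ∷ u , y)  = refl
    from∘to (false ∷ u , y) = refl

  T×↔ : ∀ p {A : Set} {n} → A ↔ Fin n → (T p × A) ↔ Fin (if p then n else 0)
  T×↔ true  A↔ = A↔ ↔-∘ mk↔ₛ′ proj₂ (tt ,_) (λ _ → refl) (λ _ → refl)
  T×↔ false A↔ = ↔-sym 0↔⊥ ↔-∘ mk↔ₛ′ proj₁ (λ ()) (λ ()) (λ ())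

  T↔ : ∀ p → T p ↔ Fin (if p then 1 else 0)
  T↔ true  = ↔-sym 1↔⊤
  T↔ false = ↔-sym 0↔⊥

  Link : ∀ b n → Word (suc n + b) → Set
  Link b n v =
    Σ (Word (n + b)) λ u → T (accept (run none v (u ∷ʳ true))) ×
    Σ (Word (n + b)) λ u′ → T (accept (run none u u′)) × Chain b n u′

  base↔ : ∀ b v → Chain b zero v ↔ T (noneTrue v)
  base↔ b v = mk↔ₛ′ to base (λ _ → refl) base∘to
    where
    to : Chain b zero v → T (noneTrue v)
    to (base p) = p
    base∘to : ∀ x → base (to x) ≡ x
    base∘to (base p) = refl

  link↔ : ∀ b n v → Chain b (suc n) v ↔ Link b n v
  link↔ b n v = mk↔ₛ′ to from (λ _ → refl) from∘to
    where
    to : Chain b (suc n) v → Link b n v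
    to (link u p u′ p′ x) = u , p , u′ , p′ , x
    from : Link b n v → Chain b (suc n) v
    from (u , p , u′ , p′ , x) = link u p u′ p′ x
    from∘to : ∀ x → from (to x) ≡ x
    from∘to (link u p u′ p′ x) = refl

  Chain↔ : ∀ b n v → Chain b n v ↔ Fin (count b n v)
  Chain↔ b zero    v = T↔ (noneTrue v) ↔-∘ base↔ b v
  Chain↔ b (suc n) v =
    Σ-Word↔ (λ u → T×↔ (accept (run none v (u ∷ʳ true)))
      (Σ-Word↔ λ u′ → T×↔ (accept (run none u u′)) (Chain↔ b n u′)))
    ↔-∘ link↔ b n v

  bit : ∀ {m} → Word m → ℕ → Bool
  bit []      i       = false
  bit (x ∷ v) zero    = x
  bit (x ∷ v) (suc i) = bit v i

  row : (ℕ → Bool) → ∀ m → Word m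
  row f zero    = []
  row f (suc m) = f 0 ∷ row (f ∘ suc) m

  bit-row : ∀ f {m i} → i < m → bit (row f m) i ≡ f i
  bit-row f {suc m} {zero}  _         = refl
  bit-row f {suc m} {suc i} (s≤s i<m) = bit-row (f ∘ suc) i<m

  row-cong : ∀ {f g : ℕ → Bool} m → (∀ i → i < m → f i ≡ g i) → row f m ≡ row g m
  row-cong zero    eq = refl
  row-cong (suc m) eq = cong₂ _∷_ (eq 0 z<s) (row-cong m (λ i i<m → eq (suc i) (s<s i<m)))

  row-bit : ∀ {m} (v : Word m) → row (bit v) m ≡ v
  row-bit []      = refl
  row-bit (x ∷ v) = cong (x ∷_) (row-bit v)

  row-∷ʳ : ∀ f m → row f (suc m) ≡ row f m ∷ʳ f m
  row-∷ʳ f zero    = refl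
  row-∷ʳ f (suc m) = cong (f 0 ∷_) (row-∷ʳ (f ∘ suc) m)

  bit-∷ʳ-last : ∀ {m} (v : Word m) x → bit (v ∷ʳ x) m ≡ x
  bit-∷ʳ-last []      x = refl
  bit-∷ʳ-last (y ∷ v) x = bit-∷ʳ-last v x

  bit-∷ʳ : ∀ {m} (v : Word m) x {i} → i < m → bit (v ∷ʳ x) i ≡ bit v i
  bit-∷ʳ (y ∷ v) x {zero}  _         = refl
  bit-∷ʳ (y ∷ v) x {suc i} (s≤s i<m) = bit-∷ʳ v x i<m

  -- Recursion at the far end gives names to the intermediate states of `run`. The carry after i
  -- steps tells whether the ▽ just passed is joined to the △ at i, that is, whether a certain
  -- lozenge with side `e₂` is present.
  carryFrom : Carry → (ℕ → Bool) → (ℕ → Bool) → ℕ → Carry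
  carryFrom s f g zero    = s
  carryFrom s f g (suc i) = step (carryFrom s f g i) (f i) (g i)

  carry : (ℕ → Bool) → (ℕ → Bool) → ℕ → Carry
  carry = carryFrom none

  carry-cong : ∀ {f f′ g g′ : ℕ → Bool} i → (∀ k → k < i → f k ≡ f′ k) → (∀ k → k < i → g k ≡ g′ k) →
               carry f g i ≡ carry f′ g′ i
  carry-cong zero    p q = refl
  carry-cong {f} {f′} {g} {g′} (suc i) p q
    rewrite carry-cong {f} {f′} {g} {g′} i (λ k k<i → p k (m<n⇒m<1+n k<i)) (λ k k<i → q k (m<n⇒m<1+n k<i))
          | p i ≤-refl | q i ≤-refl = refl

  carryFrom-suc : ∀ s f g m → carryFrom s f g (suc m) ≡ carryFrom (step s (f 0) (g 0)) (f ∘ suc) (g ∘ suc) m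
  carryFrom-suc s f g zero    = refl
  carryFrom-suc s f g (suc m) = cong (λ r → step r (f (suc m)) (g (suc m))) (carryFrom-suc s f g m)

  run-row : ∀ s f g m → run s (row f m) (row g m) ≡ carryFrom s f g m
  run-row s f g zero    = refl
  run-row s f g (suc m) = trans (run-row (step s (f 0) (g 0)) (f ∘ suc) (g ∘ suc) m) (sym (carryFrom-suc s f g m))

  -- Unlike `n + n` or `2 * n` this computes to two successors, so that consecutive lines match by
  -- definition.
  dbl : ℕ → ℕ
  dbl zero    = zero
  dbl (suc n) = suc (suc (dbl n))

  -- Line dbl h carries h bits; line suc (dbl h) carries h bits followed by the
  -- bit of its middle edge, which lies on the axis.
  record Lines (b n : ℕ) (R : ℕ → ℕ → Bool) : Set where
    field
      bottom  : ∀ i → i < b → R (dbl b) i ≡ false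
      middle  : ∀ {m} → m < n → R (suc (dbl (m + b))) (m + b) ≡ true
      evenCol : ∀ {m} → m < n → carry (R (suc (dbl (m + b)))) (R (dbl (m + b))) (m + b) ≡ none
      oddCol  : ∀ {m} → m < n →
                carry (R (dbl (suc (m + b)))) (R (suc (dbl (m + b)))) (suc (m + b)) ≡ none

  lines-pred : ∀ {b n R} → Lines b (suc n) R → Lines b n R
  lines-pred L = record
    { bottom  = bottom
    ; middle  = middle ∘ m<n⇒m<1+n
    ; evenCol = evenCol ∘ m<n⇒m<1+n
    ; oddCol  = oddCol ∘ m<n⇒m<1+n
    } where open Lines L

  noneTrue-row : ∀ f m → (∀ i → i < m → f i ≡ false) → noneTrue (row f m) ≡ true
  noneTrue-row f zero    f≡ = refl
  noneTrue-row f (suc m) f≡ rewrite f≡ 0 z<s = noneTrue-row (f ∘ suc) m (λ i i<m → f≡ (suc i) (s<s i<m))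

  noneTrue-bit : ∀ {m} (v : Word m) i → T (noneTrue v) → bit v i ≡ false
  noneTrue-bit []          i       p = refl
  noneTrue-bit (false ∷ v) zero    p = refl
  noneTrue-bit (false ∷ v) (suc i) p = noneTrue-bit v i p

  accept-none : ∀ s → s ≡ none → T (accept s)
  accept-none s refl = tt

  none-accept : ∀ s → T (accept s) → s ≡ none
  none-accept none p = refl

  build : ∀ {b} n {R} → Lines b n R → Chain b n (row (R (dbl (n + b))) (n + b))
  build {b} zero {R} L = base (Equivalence.from T-≡ (noneTrue-row (R (dbl b)) b (Lines.bottom L)))
  build {b} (suc n) {R} L =
    link (row O h) (accept-none _ odd-none) (row (R (dbl h)) h) (accept-none _ even-none) (build n (lines-pred L))
    where
    open Lines L
    h : ℕ
    h = n + b
    O : ℕ → Bool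
    O = R (suc (dbl h))
    odd-none : run none (row (R (dbl (suc h))) (suc h)) (row O h ∷ʳ true) ≡ none
    odd-none = trans
      (cong (run none (row (R (dbl (suc h))) (suc h)))
        (sym (trans (row-∷ʳ O h) (cong (row O h ∷ʳ_) (middle ≤-refl)))))
      (trans (run-row none (R (dbl (suc h))) O (suc h)) (oddCol ≤-refl))
    even-none : run none (row O h) (row (R (dbl h)) h) ≡ none
    even-none = trans (run-row none O (R (dbl h)) h) (evenCol ≤-refl)

  override : ℕ → (ℕ → Bool) → (ℕ → ℕ → Bool) → ℕ → ℕ → Bool
  override t f R t′ with t′ ≟ t
  ... | yes _ = f
  ... | no  _ = R t′

  override-same : ∀ t {f R} i → override t f R t i ≡ f i
  override-same t i with t ≟ t
  ... | yes _  = refl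
  ... | no t≢t = ⊥-elim (t≢t refl)

  override-other : ∀ {t t′ f R} → t′ < t → ∀ i → override t f R t′ i ≡ R t′ i
  override-other {t} {t′} t′<t i with t′ ≟ t
  ... | yes refl = ⊥-elim (<-irrefl refl t′<t)
  ... | no  _    = refl

  bits : ∀ {b n v} → Chain b n v → ℕ → ℕ → Bool
  bits (base _) _ _ = false
  bits {b} {suc n} {v} (link u _ _ _ x) =
    override (dbl (suc (n + b))) (bit v) (override (suc (dbl (n + b))) (bit (u ∷ʳ true)) (bits x))

  oddWord evenWord : ∀ {b n v} → Chain b (suc n) v → Word (n + b)
  oddWord  (link u _ _  _ _) = u
  evenWord (link _ _ u′ _ _) = u′

  rest : ∀ {b n v} (x : Chain b (suc n) v) → Chain b n (evenWord x)
  rest (link _ _ _ _ x) = x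

  bits-odd : ∀ {b n v} (x : Chain b (suc n) v) i → bits x (suc (dbl (n + b))) i ≡ bit (oddWord x ∷ʳ true) i
  bits-odd {b} {n} {v} (link u _ _ _ x) i = trans
    (override-other {suc (suc (dbl (n + b)))} {suc (dbl (n + b))} {bit v} {override (suc (dbl (n + b))) (bit (u ∷ʳ true)) (bits x)} ≤-refl i)
    (override-same (suc (dbl (n + b))) {bit (u ∷ʳ true)} {bits x} i)

  bits-odd-below : ∀ {b n v} (x : Chain b (suc n) v) {i} → i < n + b →
                   bits x (suc (dbl (n + b))) i ≡ bit (oddWord x) i
  bits-odd-below x {i} i<h = trans (bits-odd x i) (bit-∷ʳ (oddWord x) true i<h)

  bits-below : ∀ {b n v} (x : Chain b (suc n) v) {t} → t ≤ dbl (n + b) → ∀ i → bits x t i ≡ bits (rest x) t i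
  bits-below {b} {n} {v} (link u _ _ _ x) {t} t≤ i = trans
    (override-other {f = bit v} {override (suc (dbl (n + b))) (bit (u ∷ʳ true)) (bits x)} (s≤s (m≤n⇒m≤1+n t≤)) i)
    (override-other {f = bit (u ∷ʳ true)} {bits x} (s≤s t≤) i)

  bits-top : ∀ {b n v} (x : Chain b n v) i → bits x (dbl (n + b)) i ≡ bit v i
  bits-top {v = v} (base p) i = sym (noneTrue-bit v i p)
  bits-top {b} {suc n} {v} (link u _ _ _ x) i =
    override-same (dbl (suc (n + b))) {bit v} {override (suc (dbl (n + b))) (bit (u ∷ʳ true)) (bits x)} i

  dbl-mono : ∀ {m n} → m ≤ n → dbl m ≤ dbl n
  dbl-mono z≤n       = z≤n
  dbl-mono (s≤s m≤n) = s≤s (s≤s (dbl-mono m≤n))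

  carry-bit : ∀ {m f g} (v u : Word m) → (∀ i → i < m → f i ≡ bit v i) → (∀ i → i < m → g i ≡ bit u i) →
              T (accept (run none v u)) → carry f g m ≡ none
  carry-bit {m} {f} {g} v u fv gu p = begin
    carry f g m                               ≡⟨ carry-cong m fv gu ⟩
    carry (bit v) (bit u) m                   ≡⟨ run-row none (bit v) (bit u) m ⟨
    run none (row (bit v) m) (row (bit u) m)  ≡⟨ cong₂ (run none) (row-bit v) (row-bit u) ⟩
    run none v u                              ≡⟨ none-accept _ p ⟩
    none                                      ∎
    where open ≡-Reasoning

  bits-lines : ∀ {b n v} (x : Chain b n v) → Lines b n (bits x)
  bits-lines {b} (base p) = record
    { bottom = λ _ _ → refl ; middle = λ () ; evenCol = λ () ; oddCol = λ () }
  bits-lines {b} {suc n} {v} x@(link u p u′ p′ x′) = record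
    { bottom  = λ i i<b → trans (below (dbl-mono (m≤n+m b n)) i) (bottom i i<b)
    ; middle  = λ m<1+n → mid (m<1+n⇒m<n∨m≡n m<1+n)
    ; evenCol = λ m<1+n → even (m<1+n⇒m<n∨m≡n m<1+n)
    ; oddCol  = λ m<1+n → odd (m<1+n⇒m<n∨m≡n m<1+n)
    }
    where
    open Lines (bits-lines x′)
    h : ℕ
    h = n + b
    B : ℕ → ℕ → Bool
    B = bits x
    below : ∀ {t} → t ≤ dbl h → ∀ i → B t i ≡ bits x′ t i
    below t≤ i = bits-below x t≤ i
    dbl≤ : ∀ {m} → m < n → suc (suc (dbl (m + b))) ≤ dbl h
    dbl≤ m<n = dbl-mono (+-monoˡ-≤ b m<n)
    mid : ∀ {m} → m < n ⊎ m ≡ n → B (suc (dbl (m + b))) (m + b) ≡ true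
    mid (inj₁ m<n)  = trans (below (<⇒≤ (dbl≤ m<n)) _) (middle m<n)
    mid (inj₂ refl) = trans (bits-odd x h) (bit-∷ʳ-last u true)
    even : ∀ {m} → m < n ⊎ m ≡ n → carry (B (suc (dbl (m + b)))) (B (dbl (m + b))) (m + b) ≡ none
    even {m} (inj₁ m<n) = trans (carry-cong (m + b) (λ i _ → below (<⇒≤ (dbl≤ m<n)) i) (λ i _ → below (<⇒≤ (<⇒≤ (dbl≤ m<n))) i)) (evenCol m<n)
    even (inj₂ refl) = carry-bit u u′
      (λ i i<h → trans (bits-odd x i) (bit-∷ʳ u true i<h))
      (λ i i<h → trans (below ≤-refl i) (bits-top x′ i)) p′
    odd : ∀ {m} → m < n ⊎ m ≡ n →
          carry (B (dbl (suc (m + b)))) (B (suc (dbl (m + b)))) (suc (m + b)) ≡ none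
    odd {m} (inj₁ m<n) = trans (carry-cong (suc (m + b)) (λ i _ → below (dbl≤ m<n) i) (λ i _ → below (<⇒≤ (dbl≤ m<n)) i)) (oddCol m<n)
    odd (inj₂ refl) = carry-bit v (u ∷ʳ true)
      (λ i _ → bits-top x i) (λ i _ → bits-odd x i) p

  -- The bits with i + i < t are those strictly on one side of the axis.
  Agree : ℕ → ℕ → (ℕ → ℕ → Bool) → (ℕ → ℕ → Bool) → Set
  Agree b n R S = ∀ t i → dbl b ≤ t → t ≤ dbl (n + b) → i + i < t → R t i ≡ S t i

  dbl≡+ : ∀ n → dbl n ≡ n + n
  dbl≡+ zero    = refl
  dbl≡+ (suc n) = cong suc (trans (cong suc (dbl≡+ n)) (sym (+-suc n n)))

  i<h⇒i+i<dbl : ∀ {i h} → i < h → i + i < dbl h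
  i<h⇒i+i<dbl {i} {h} i<h = subst (i + i <_) (sym (dbl≡+ h)) (+-mono-< i<h i<h)

  i+i<dbl⇒i<h : ∀ h {i} → i + i < dbl h → i < h
  i+i<dbl⇒i<h h {i} p = ≰⇒> λ h≤i → <⇒≱ (subst (i + i <_) (dbl≡+ h) p) (+-mono-≤ h≤i h≤i)

  bit-injective : ∀ {m} (v u : Word m) → (∀ i → i < m → bit v i ≡ bit u i) → v ≡ u
  bit-injective {m} v u eq = trans (sym (row-bit v)) (trans (row-cong m eq) (row-bit u))

  -- Acceptance proofs have type `T _`, hence are unique, and the words can be read off the bits on
  -- one side of the axis. The equality is one of pairs because `v` and `v′` are identified only on
  -- the way.
  bits-injective : ∀ {b n v v′} (x : Chain b n v) (y : Chain b n v′) →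
                   Agree b n (bits x) (bits y) → _≡_ {A = Σ (Word (n + b)) (Chain b n)} (v , x) (v′ , y)
  bits-injective {v = v} {v′} (base p) (base q) eq
    with refl ← bit-injective v v′ (λ i _ → trans (noneTrue-bit v i p) (sym (noneTrue-bit v′ i q)))
    = cong (λ p → v , base p) (T-irrelevant p q)
  bits-injective {b} {suc n} {v} {v′} x@(link u p u₂ q x′) y@(link w r w₂ s y′) eq
    with refl ← bit-injective v v′ (λ i i<1+h → trans (sym (bits-top x i))
                  (trans (eq _ i (dbl-mono (m≤n+m b (suc n))) ≤-refl (i<h⇒i+i<dbl i<1+h)) (bits-top y i)))
    with refl ← bit-injective u w (λ i i<h → trans (sym (bits-odd-below x i<h))
                  (trans (eq _ i (m≤n⇒m≤1+n (dbl-mono (m≤n+m b n))) (n≤1+n _) (m<n⇒m<1+n (i<h⇒i+i<dbl i<h))) (bits-odd-below y i<h)))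
    with refl ← bits-injective x′ y′ (λ t i b≤t t≤ i< →
                  trans (sym (bits-below x t≤ i))
                  (trans (eq t i b≤t (m≤n⇒m≤1+n (m≤n⇒m≤1+n t≤)) i<) (bits-below y t≤ i)))
    with refl ← T-irrelevant p r
    with refl ← T-irrelevant q s
    = refl

  bits-build : ∀ {b} n {R} (L : Lines b n R) → Agree b n (bits (build n L)) R
  bits-build {b} zero {R} L t i b≤t t≤b i<
    with refl ← ≤-antisym b≤t t≤b = sym (Lines.bottom L i (i+i<dbl⇒i<h b i<))
  bits-build {b} (suc n) {R} L t i b≤t t≤ i<
    with m≤n⇒m<n∨m≡n t≤
  ... | inj₂ refl = trans (bits-top (build (suc n) L) i) (bit-row (R t) {suc (n + b)} (i+i<dbl⇒i<h (suc (n + b)) i<))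
  ... | inj₁ (s≤s t≤′) with m≤n⇒m<n∨m≡n t≤′
  ...   | inj₁ (s≤s t≤h) = trans (bits-below (build (suc n) L) t≤h i)
                            (bits-build n (lines-pred L) t i b≤t t≤h i<)
  ...   | inj₂ refl = trans (bits-odd (build (suc n) L) i)
                     (trans (cong (λ w → bit w i) row≡) (bit-row (R t) {suc (n + b)} half))
    where
    row≡ : row (R t) (n + b) ∷ʳ true ≡ row (R t) (suc (n + b))
    row≡ = sym (trans (row-∷ʳ (R t) (n + b)) (cong (row (R t) (n + b) ∷ʳ_) (Lines.middle L ≤-refl)))
    half : i < suc (n + b)
    half = i+i<dbl⇒i<h (suc (n + b)) (m<n⇒m<1+n i<)

-- Symmetric coverings in natural coordinates, and their construction from lines of bits

module Bricks where

  open import Data.Bool.Base using (Bool; true; false; not; _∧_; _∨_)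
  open import Data.Nat.Base hiding (parity)
  open import Data.Nat.Properties
  open import Data.Product using (Σ; _×_; _,_; proj₁)
  open import Data.Sum.Base using (inj₁; inj₂)
  open import Data.Empty using (⊥; ⊥-elim)
  open import Relation.Nullary
  open import Relation.Binary.Definitions using (tri<; tri≈; tri>)
  open import Relation.Nullary.Decidable using (_×-dec_)
  open import Relation.Binary.PropositionalEquality
  open Transfer
  open Counting
  open Chains

  data One : Bool → Bool → Bool → Set where
    first  : One true false false
    second : One false true false
    third  : One false false true

  One-swap : ∀ {x y z} → One x y z → One x z y
  One-swap first  = first
  One-swap second = third
  One-swap third  = second

  -- Reflection exchanges two of the lozenges around a triangle on the axis. They are present
  -- together, hence absent, which forces the third.
  One-diagonal : ∀ {x y} → One x y y → x ≡ true × y ≡ false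
  One-diagonal first = refl , refl

  Cell : (N lo hi t i j : ℕ) → Set
  Cell N lo hi t i j = (i < N × j < N) × (lo ≤ t × t < hi)

  cell? : ∀ N lo hi t i j → Dec (Cell N lo hi t i j)
  cell? N lo hi t i j = (i <? N ×-dec j <? N) ×-dec (lo ≤? t ×-dec t <? hi)

  -- △ and ▽ at (i , j) lie in the hexagon, where (i , j) stands for the point
  -- (i - c , j), and N = a + c, lo = c, hi = 2a + c.
  Up Down : (N lo hi i j : ℕ) → Set
  Up   N lo hi i j = Cell N lo hi (i + j) i j
  Down N lo hi i j = Cell N lo hi (suc (i + j)) i j

  Cell-swap : ∀ {N lo hi t t′ i j} → t ≡ t′ → Cell N lo hi t i j → Cell N lo hi t′ j i
  Cell-swap refl ((i< , j<) , t∈) = (j< , i<) , t∈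

  Up-swap : ∀ {N lo hi} i j → Up N lo hi i j → Up N lo hi j i
  Up-swap i j = Cell-swap (+-comm i j)

  Down-swap : ∀ {N lo hi} i j → Down N lo hi i j → Down N lo hi j i
  Down-swap i j = Cell-swap (cong suc (+-comm i j))

  -- The lozenges with △ at (i , j) have ▽ at (i , j), (i ∸ 1 , j) or (i , j ∸ 1);
  -- w and s tell whether the first and the second are present, and by symmetry
  -- s j i does so for the third.
  record Brick (N lo hi : ℕ) : Set where
    field
      w s    : ℕ → ℕ → Bool
      w-sym  : ∀ i j → w i j ≡ w j i
      w-in   : ∀ i j → w i j ≡ true → Up N lo hi i j × Down N lo hi i j
      s-zero : ∀ j → s 0 j ≡ false
      s-in   : ∀ i j → s (suc i) j ≡ true → Up N lo hi (suc i) j × Down N lo hi i j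
      cover△ : ∀ i j → Up N lo hi i j → One (w i j) (s i j) (s j i)
      cover▽ : ∀ i j → Down N lo hi i j → One (w i j) (s (suc i) j) (s (suc j) i)

  isSome : Carry → Bool
  isSome none = false
  isSome some = true
  isSome fail = false

  -- A △ is covered across the later line (`v`), by the preceding ▽ (carry `some`) or else by the
  -- following ▽. The last case is exactly `not v ∧ accept σ`, since a △ claimed twice leads to
  -- `fail`.
  step-one△ : ∀ σ v u → step σ v u ≢ fail → One v (isSome σ) (not v ∧ accept σ)
  step-one△ none false _     _  = third
  step-one△ none true  _     _  = first
  step-one△ some false _     _  = second
  step-one△ some true  _     ok = ⊥-elim (ok refl)
  step-one△ fail _     _     ok = ⊥-elim (ok refl)

  step-one▽ : ∀ σ v u → step σ v u ≢ fail → One u (isSome (step σ v u)) (not v ∧ accept σ)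
  step-one▽ none false false _  = third
  step-one▽ none false true  ok = ⊥-elim (ok refl)
  step-one▽ none true  false _  = second
  step-one▽ none true  true  _  = first
  step-one▽ some false false _  = second
  step-one▽ some false true  _  = first
  step-one▽ some true  _     ok = ⊥-elim (ok refl)
  step-one▽ fail _     _     ok = ⊥-elim (ok refl)

  ⟦_⟧ : Bool → Carry
  ⟦ true ⟧  = some
  ⟦ false ⟧ = none

  -- Converse of `step-one△` and `step-one▽`: `b` is the lozenge joining the △ to the ▽ that follows
  -- it, and so occurs in both covering conditions.
  step-One : ∀ {v s b u s′} → One v s b → One u s′ b → step ⟦ s ⟧ v u ≡ ⟦ s′ ⟧
  step-One first  first  = refl
  step-One first  second = refl
  step-One second first  = refl
  step-One second second = refl
  step-One third  third  = refl

  isSome-⟦⟧ : ∀ s → isSome ⟦ s ⟧ ≡ s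
  isSome-⟦⟧ true  = refl
  isSome-⟦⟧ false = refl

  One-third : ∀ {v s b} → One v s b → not v ∧ accept ⟦ s ⟧ ≡ b
  One-third first  = refl
  One-third second = refl
  One-third third  = refl

  carry-alive : ∀ {f g : ℕ → Bool} {i k} → i ≤ k → carry f g k ≢ fail → carry f g i ≢ fail
  carry-alive {f} {g} i≤k ok = go (≤⇒≤′ i≤k) ok
    where
    go : ∀ {i k} → i ≤′ k → carry f g k ≢ fail → carry f g i ≢ fail
    go ≤′-refl          ok = ok
    go (≤′-step {k} le) ok = go le (λ eq → ok (cong (λ s → step s (f k) (g k)) eq))

  none≢fail : ∀ {s} → s ≡ none → s ≢ fail
  none≢fail refl ()

  -- A false bit in g below the leading trues of f would let two trues of f meet.
  carry-prefix : ∀ {f g : ℕ → Bool} {r} → (∀ i → i ≤ r → f i ≡ true) → carry f g (suc r) ≢ fail →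
                 ∀ i → i < r → g i ≡ true
  carry-prefix {f} {g} {r} f≡ ok = λ i i<r → here i i<r (before i (<⇒≤ i<r))
    where
    here : ∀ i → i < r → carry f g i ≡ none → g i ≡ true
    here i i<r eq with g i in gi
    ... | true  = refl
    ... | false = ⊥-elim (carry-alive {f} {g} {suc (suc i)} (s≤s i<r) ok dead)
      where
      dead : carry f g (suc (suc i)) ≡ fail
      dead rewrite eq | gi | f≡ i (<⇒≤ i<r) | f≡ (suc i) i<r = refl
    before : ∀ i → i ≤ r → carry f g i ≡ none
    before zero    _   = refl
    before (suc i) i<r rewrite before i (<⇒≤ i<r) | here i i<r (before i (<⇒≤ i<r)) | f≡ i (<⇒≤ i<r) = refl

  data Parity : ℕ → Set where
    even : ∀ h → Parity (dbl h)
    odd  : ∀ h → Parity (suc (dbl h))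

  parity : ∀ t → Parity t
  parity zero = even 0
  parity (suc t) with parity t
  ... | even h = odd h
  ... | odd h  = even (suc h)

  dbl-cancel : ∀ {m n} → dbl m ≤ suc (dbl n) → m ≤ n
  dbl-cancel {zero}          _             = z≤n
  dbl-cancel {suc m} {zero}  (s≤s ())
  dbl-cancel {suc m} {suc n} (s≤s (s≤s p)) = s≤s (dbl-cancel p)

  +≤dbl : ∀ {i j t} → i ≤ j → i + j ≡ t → dbl i ≤ t
  +≤dbl {i} i≤j refl = ≤-trans (≤-reflexive (dbl≡+ i)) (+-monoʳ-≤ i i≤j)

  guard-true : ∀ {P : Set} (P? : Dec P) {x} → does P? ∧ x ≡ true → P × x ≡ true
  guard-true (yes p) eq = p , eq

  true-guard : ∀ {P : Set} (P? : Dec P) {x} → P → x ≡ true → does P? ∧ x ≡ true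
  true-guard (yes _) _ eq = eq
  true-guard (no ¬p) p eq = ⊥-elim (¬p p)

  guarded : ∀ {P : Set} (P? : Dec P) {x} → (x ≡ true → P) → does P? ∧ x ≡ x
  guarded (yes p)         imp = refl
  guarded (no ¬p) {false} imp = refl
  guarded (no ¬p) {true}  imp = ⊥-elim (¬p (imp refl))

  true≢false : ∀ {x} → x ≡ true → x ≡ false → ⊥
  true≢false refl ()

  ≢true : ∀ {x} → (x ≡ true → ⊥) → x ≡ false
  ≢true {true}  f = ⊥-elim (f refl)
  ≢true {false} f = refl

  bool-ext : ∀ {x y} → (x ≡ true → y ≡ true) → (y ≡ true → x ≡ true) → x ≡ y
  bool-ext {true}  {y}     f g = sym (f refl)
  bool-ext {false} {true}  f g = g refl
  bool-ext {false} {false} f g = refl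

  One-subst : ∀ {x x′ y y′ z z′} → x ≡ x′ → y ≡ y′ → z ≡ z′ → One x′ y′ z′ → One x y z
  One-subst refl refl refl one = one

  -- R t i is the bit of the edge at (i , j) with suc (i + j) = t.  The hexagon is
  -- completed to a trapezoid by a triangle, j ≥ N, in which all lozenges are
  -- forced to have side e₂-e₁; hence the bits prescribed on the top line.
  module Decode (a b : ℕ) {R : ℕ → ℕ → Bool} (L : Lines b a R)
                (top-true : ∀ i → i < a → R (dbl (a + b)) i ≡ true)
                (top-false : ∀ i → a ≤ i → i < a + b → R (dbl (a + b)) i ≡ false) where

    open Lines L

    N lo hi : ℕ
    N  = a + dbl b
    lo = dbl b
    hi = dbl (a + b)

    hi≡ : hi ≡ a + N
    hi≡ = begin
      dbl (a + b)       ≡⟨ dbl≡+ (a + b) ⟩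
      a + b + (a + b)   ≡⟨ +-assoc a b (a + b) ⟩
      a + (b + (a + b)) ≡⟨ cong (a +_) (trans (sym (+-assoc b a b)) (trans (cong (_+ b) (+-comm b a)) (+-assoc a b b))) ⟩
      a + (a + (b + b)) ≡⟨ cong (λ d → a + (a + d)) (dbl≡+ b) ⟨
      a + N ∎
      where open ≡-Reasoning

    col : ℕ → ℕ → Carry
    col t = carry (R (suc t)) (R t)

    split : ∀ {h} → b ≤ h → h < a + b → Σ ℕ λ m → (m < a) × (m + b ≡ h)
    split {h} b≤h h< = h ∸ b , +-cancelʳ-< b (h ∸ b) a (subst (_< a + b) (sym (m∸n+n≡m b≤h)) h<) , m∸n+n≡m b≤h

    halfway : ∀ {t} → dbl t < hi → t < a + b
    halfway p = ≰⇒> λ q → <⇒≱ p (dbl-mono q)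

    even-none : ∀ {h} → lo ≤ dbl h → dbl h < hi → col (dbl h) h ≡ none
    even-none l u with split (dbl-cancel (m≤n⇒m≤1+n l)) (halfway u)
    ... | m , m<a , refl = evenCol m<a

    odd-none : ∀ {h} → lo ≤ suc (dbl h) → suc (dbl h) < hi → col (suc (dbl h)) (suc h) ≡ none
    odd-none l u with split (dbl-cancel l) (halfway (<⇒≤ u))
    ... | m , m<a , refl = oddCol m<a

    axis-true : ∀ {i} → lo ≤ suc (dbl i) → suc (dbl i) < hi → R (suc (dbl i)) i ≡ true
    axis-true l u with split (dbl-cancel l) (halfway (<⇒≤ u))
    ... | m , m<a , refl = middle m<a

    -- `fail` is absorbing, so carry `none` on reaching the axis excludes it everywhere before.
    alive : ∀ {t i} → lo ≤ t → t < hi → dbl i ≤ suc t → col t i ≢ fail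
    alive {t} l u i≤ with parity t
    ... | even h = carry-alive (dbl-cancel i≤) (none≢fail (even-none l u))
    ... | odd h  = carry-alive (dbl-cancel (m≤n⇒m≤1+n i≤)) (none≢fail (odd-none l u))

    -- Induction on the distance `d` to the top line, whose leading true bits are prescribed. Each
    -- line further down has one fewer of them, by `carry-prefix`.
    forced : ∀ d t → t + d ≡ hi → lo ≤ t → ∀ i → i + N < t → R t i ≡ true
    forced zero t eq l i i< with refl ← trans (sym (+-identityʳ t)) eq =
      top-true i (+-cancelʳ-< N i a (subst (i + N <_) hi≡ i<))
    forced (suc d) t eq l i i< =
      carry-prefix {R (suc t)} {R t} {suc i}
        (λ k k≤ → forced d (suc t) (trans (sym (+-suc t d)) eq) (m≤n⇒m≤1+n l) k (≤-trans (s≤s (+-monoˡ-≤ N k≤)) (s≤s i<)))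
        (alive l t<hi 2i+4≤)
        i ≤-refl
      where
      t<hi : t < hi
      t<hi = subst (t <_) eq (subst (suc t ≤_) (sym (+-suc t d)) (s≤s (m≤m+n t d)))
      i<a : suc (suc i) ≤ a
      i<a = +-cancelʳ-≤ N (suc (suc i)) a (subst (suc (suc (i + N)) ≤_) hi≡ (≤-trans (s≤s i<) t<hi))
      -- The first i + 2 bits are inspected, and they have to lie before the axis.
      2i+4≤ : dbl (suc (suc i)) ≤ suc t
      2i+4≤ = begin
        suc (suc (suc (suc (dbl i))))  ≡⟨ cong (λ d → suc (suc (suc (suc d)))) (dbl≡+ i) ⟩
        suc (suc (suc (suc (i + i))))  ≡⟨ cong (λ d → suc (suc d)) (trans (cong suc (sym (+-suc i i))) (sym (+-suc i (suc i)))) ⟩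
        suc (suc (i + suc (suc i)))    ≤⟨ s≤s (s≤s (+-monoʳ-≤ i (≤-trans i<a (m≤m+n a (dbl b))))) ⟩
        suc (suc (i + N))              ≤⟨ s≤s i< ⟩
        suc t                          ∎
        where open ≤-Reasoning

    V : ℕ → ℕ → Bool
    V i j = R (suc (i + j)) i

    σ : ℕ → ℕ → Carry
    σ i j = col (i + j) i

    -- The bits describe the half i ≤ j. For j < i the lozenge with side `e₂` at (i , j) mirrors the
    -- one with side `e₁` at (j , i), which is the third possibility for its △.
    rawW rawS : ℕ → ℕ → Bool
    rawW i j with i ≤? j
    ... | yes _ = V i j
    ... | no _  = V j i
    rawS i j with i ≤? j
    ... | yes _ = isSome (σ i j)
    ... | no _  = not (V j i) ∧ accept (σ j i)

    rawW-≤ : ∀ {i j} → i ≤ j → rawW i j ≡ V i j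
    rawW-≤ {i} {j} i≤j with i ≤? j
    ... | yes _  = refl
    ... | no i≰j = ⊥-elim (i≰j i≤j)

    rawW-> : ∀ {i j} → j < i → rawW i j ≡ V j i
    rawW-> {i} {j} j<i with i ≤? j
    ... | yes i≤j = ⊥-elim (<⇒≱ j<i i≤j)
    ... | no _    = refl

    rawS-≤ : ∀ {i j} → i ≤ j → rawS i j ≡ isSome (σ i j)
    rawS-≤ {i} {j} i≤j with i ≤? j
    ... | yes _  = refl
    ... | no i≰j = ⊥-elim (i≰j i≤j)

    rawS-> : ∀ {i j} → j < i → rawS i j ≡ not (V j i) ∧ accept (σ j i)
    rawS-> {i} {j} j<i with i ≤? j
    ... | yes i≤j = ⊥-elim (<⇒≱ j<i i≤j)
    ... | no _    = refl

    up? : ∀ i j → Dec (Up N lo hi i j)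
    up? i j = cell? N lo hi (i + j) i j

    down? : ∀ i j → Dec (Down N lo hi i j)
    down? i j = cell? N lo hi (suc (i + j)) i j

    -- The raw values also describe the completing triangle and are arbitrary elsewhere, so both
    -- halves of a lozenge are required to lie in the hexagon.
    w s : ℕ → ℕ → Bool
    w i j = does (up? i j ×-dec down? i j) ∧ rawW i j
    s zero    j = false
    s (suc i) j = does (up? (suc i) j ×-dec down? i j) ∧ rawS (suc i) j

    free : ℕ → ℕ → Bool
    free i j = not (V i j) ∧ accept (σ i j)

    bottom-false : ∀ {i j} → i ≤ j → suc (i + j) ≡ lo → V i j ≡ false
    bottom-false {i} {j} i≤j eq = trans (cong (λ t → R t i) eq)
      (bottom i (i+i<dbl⇒i<h b (≤-trans (s≤s (+-monoʳ-≤ i i≤j)) (≤-reflexive eq))))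

    final-false : ∀ {i j} → i ≤ j → suc (i + j) ≡ hi → j < N → V i j ≡ false
    final-false {i} {j} i≤j eq j<N = trans (cong (λ t → R t i) eq)
      (top-false i (≮⇒≥ i≮a) (i+i<dbl⇒i<h (a + b) (≤-trans (s≤s (+-monoʳ-≤ i i≤j)) (≤-reflexive eq))))
      where
      i≮a : ¬ i < a
      i≮a i<a = <⇒≢ (+-mono-<-≤ i<a j<N) (trans (+-suc i j) (trans eq hi≡))

    V⇒down : ∀ {i j} → i ≤ j → Up N lo hi i j → V i j ≡ true → Down N lo hi i j
    V⇒down i≤j ((i< , j<) , (l , u)) v with m≤n⇒m<n∨m≡n u
    ... | inj₁ u′ = (i< , j<) , (m≤n⇒m≤1+n l , u′)
    ... | inj₂ eq with () ← trans (sym v) (final-false i≤j eq j<)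

    V⇒up : ∀ {i j} → i ≤ j → Down N lo hi i j → V i j ≡ true → Up N lo hi i j
    V⇒up i≤j ((i< , j<) , (l , u)) v with m≤n⇒m<n∨m≡n l
    ... | inj₁ (s≤s l′) = (i< , j<) , (l′ , <⇒≤ u)
    ... | inj₂ eq with () ← trans (sym v) (bottom-false i≤j (sym eq))

    up⇒down : ∀ {i j} → Up N lo hi (suc i) j → Down N lo hi i j
    up⇒down ((i< , j<) , t∈) = (<⇒≤ i< , j<) , t∈

    w≡V : ∀ {i j} → i ≤ j → (V i j ≡ true → Up N lo hi i j × Down N lo hi i j) → w i j ≡ V i j
    w≡V {i} {j} i≤j imp =
      trans (guarded (up? i j ×-dec down? i j) (λ eq → imp (trans (sym (rawW-≤ i≤j)) eq))) (rawW-≤ i≤j)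

    s≡some : ∀ {i j} → i ≤ j → Up N lo hi i j → s i j ≡ isSome (σ i j)
    s≡some {zero}  {j} i≤j up = refl
    s≡some {suc i} {j} i≤j up =
      trans (guarded (up? (suc i) j ×-dec down? i j) (λ _ → up , up⇒down up)) (rawS-≤ i≤j)

    s≡free : ∀ {i j} → i ≤ j → (free i (suc j) ≡ true → Up N lo hi i (suc j)) → s (suc j) i ≡ free i (suc j)
    s≡free {i} {j} i≤j imp =
      trans (guarded (up? (suc j) i ×-dec down? j i) (λ eq → both (imp (trans (sym (rawS-> (s≤s i≤j))) eq))))
            (rawS-> (s≤s i≤j))
      where
      both : Up N lo hi i (suc j) → Up N lo hi (suc j) i × Down N lo hi j i
      both up = Up-swap i (suc j) up , up⇒down (Up-swap i (suc j) up)

    rawW-sym : ∀ i j → rawW i j ≡ rawW j i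
    rawW-sym i j with <-cmp i j
    ... | tri< i<j _ _  = trans (rawW-≤ (<⇒≤ i<j)) (sym (rawW-> i<j))
    ... | tri≈ _ refl _ = refl
    ... | tri> _ _ j<i  = trans (rawW-> j<i) (sym (rawW-≤ (<⇒≤ j<i)))

    w-in : ∀ i j → w i j ≡ true → Up N lo hi i j × Down N lo hi i j
    w-in i j eq = proj₁ (guard-true (up? i j ×-dec down? i j) eq)

    w-sym : ∀ i j → w i j ≡ w j i
    w-sym i j = bool-ext (imp i j) (imp j i)
      where
      imp : ∀ i j → w i j ≡ true → w j i ≡ true
      imp i j eq with ((up , down) , r) ← guard-true (up? i j ×-dec down? i j) eq =
        true-guard (up? j i ×-dec down? j i) (Up-swap i j up , Down-swap i j down) (trans (rawW-sym j i) r)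

    V-axis : ∀ {i} → lo ≤ suc (i + i) → suc (i + i) < hi → V i i ≡ true
    V-axis {i} l u = subst (λ d → R (suc d) i ≡ true) (dbl≡+ i)
      (axis-true (subst (λ d → lo ≤ suc d) (sym (dbl≡+ i)) l) (subst (λ d → suc d < hi) (sym (dbl≡+ i)) u))

    σ-axis : ∀ {i} → lo ≤ i + i → i + i < hi → σ i i ≡ none
    σ-axis {i} l u = subst (λ d → col d i ≡ none) (dbl≡+ i)
      (even-none (subst (lo ≤_) (sym (dbl≡+ i)) l) (subst (_< hi) (sym (dbl≡+ i)) u))

    cover△-≤ : ∀ {i j} → i ≤ j → Up N lo hi i j → One (w i j) (s i j) (s j i)
    cover△-≤ {i} {j} i≤j up@((i< , j<) , (l , u)) with m≤n⇒m<n∨m≡n i≤j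
    cover△-≤ {i} {suc j} i≤j up@(_ , (l , u)) | inj₁ (s≤s i≤j′) =
      One-subst (w≡V i≤j (λ v → up , V⇒down i≤j up v)) (s≡some i≤j up) (s≡free i≤j′ (λ _ → up))
        (step-one△ (σ i (suc j)) (V i (suc j)) (R (i + suc j) i)
          (alive {i = suc i} l u (+≤dbl (s≤s i≤j′) refl)))
    cover△-≤ {i} _ up@((i< , _) , (l , u)) | inj₂ refl =
      One-subst (trans (w≡V ≤-refl (λ _ → up , (i< , i<) , m≤n⇒m≤1+n l , u′)) (V-axis (m≤n⇒m≤1+n l) u′)) s≡ s≡ first
      where
      s≡ : s i i ≡ false
      s≡ = trans (s≡some ≤-refl up) (cong isSome (σ-axis {i} l u))
      -- `hi` is even, so i + i < hi leaves room for one more.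
      u′ : suc (i + i) < hi
      u′ = subst (λ d → suc d < hi) (dbl≡+ i) (dbl-mono (i+i<dbl⇒i<h (a + b) u))

    -- The only doubtful case is j + 1 = N. There the △ belongs to the completing triangle and its
    -- forced lozenge across the line leaves it not free.
    free⇒up : ∀ {i j} → Down N lo hi i j → free i (suc j) ≡ true → Up N lo hi i (suc j)
    free⇒up {i} {j} ((i< , j<) , (l , u)) fr with m≤n⇒m<n∨m≡n j<
    ... | inj₁ j+1< = (i< , j+1<) , (subst (lo ≤_) (sym (+-suc i j)) l , subst (_< hi) (sym (+-suc i j)) u)
    ... | inj₂ eq with () ← trans (sym fr) (cong (λ v → not v ∧ accept (σ i (suc j)))
            (forced (hi ∸ suc (i + suc j)) (suc (i + suc j)) (m+[n∸m]≡n (subst (_< hi) (sym (+-suc i j)) u))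
              (m≤n⇒m≤1+n (subst (lo ≤_) (sym (+-suc i j)) l)) i (s≤s (+-monoʳ-≤ i (≤-reflexive (sym eq))))))

    cover▽-≤ : ∀ {i j} → i ≤ j → Down N lo hi i j → One (w i j) (s (suc i) j) (s (suc j) i)
    cover▽-≤ {i} {j} i≤j dn@((i< , j<) , (l , u)) with m≤n⇒m<n∨m≡n i≤j
    ... | inj₁ i<j = One-subst w≡ (s≡some i<j ((≤-trans (s≤s i<j) j< , j<) , (l , u))) s≡ core
      where
      w≡ : w i j ≡ V i j
      w≡ = w≡V i≤j (λ v → V⇒up i≤j dn v , dn)
      s≡ : s (suc j) i ≡ free i (suc j)
      s≡ = s≡free i≤j (free⇒up dn)
      core : One (V i j) (isSome (σ (suc i) j)) (free i (suc j))
      core = subst (λ t → One (V i j) (isSome (σ (suc i) j)) (not (R (suc t) i) ∧ accept (col t i))) (sym (+-suc i j))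
        (step-one▽ (col (suc (i + j)) i) (R (suc (suc (i + j))) i) (V i j)
          (alive {i = suc i} l u (+≤dbl (s≤s i≤j) (cong suc (+-suc i j)))))
    -- On the axis both remaining possibilities are the one bit `s (suc i) i`, which the true middle
    -- bit excludes.
    ... | inj₂ refl = One-subst (trans w≡ v≡) s≡ s≡ first
      where
      w≡ : w i i ≡ V i i
      w≡ = w≡V i≤j (λ v → V⇒up i≤j dn v , dn)
      v≡ : V i i ≡ true
      v≡ = V-axis l u
      core : One (V i i) (isSome (σ (suc i) i)) (free i (suc i))
      core = subst (λ t → One (V i i) (isSome (σ (suc i) i)) (not (R (suc t) i) ∧ accept (col t i))) (sym (+-suc i i))
        (step-one▽ (col (suc (i + i)) i) (R (suc (suc (i + i))) i) (V i i)
          (alive {i = suc i} l u (+≤dbl (s≤s i≤j) (cong suc (+-suc i i)))))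
      One-first : ∀ {x y z} → One x y z → x ≡ true → z ≡ false
      One-first first refl = refl
      s≡ : s (suc i) i ≡ false
      s≡ = trans (s≡free i≤j (free⇒up dn)) (One-first core v≡)

    brick : Brick N lo hi
    brick = record
      { w = w ; s = s ; w-sym = w-sym ; w-in = w-in
      ; s-zero = λ _ → refl
      ; s-in = λ i j eq → proj₁ (guard-true (up? (suc i) j ×-dec down? i j) eq)
      ; cover△ = c△ ; cover▽ = c▽ }
      where
      c△ : ∀ i j → Up N lo hi i j → One (w i j) (s i j) (s j i)
      c△ i j up with ≤-total i j
      ... | inj₁ i≤j = cover△-≤ i≤j up
      ... | inj₂ j≤i = One-subst (w-sym i j) refl refl (One-swap (cover△-≤ j≤i (Up-swap i j up)))
      c▽ : ∀ i j → Down N lo hi i j → One (w i j) (s (suc i) j) (s (suc j) i)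
      c▽ i j dn with ≤-total i j
      ... | inj₁ i≤j = cover▽-≤ i≤j dn
      ... | inj₂ j≤i = One-subst (w-sym i j) refl refl (One-swap (cover▽-≤ j≤i (Down-swap i j dn)))

-- Lines of bits from symmetric coverings; encoding and decoding are inverse

module Encoding where

  open import Data.Bool.Base using (Bool; true; false; not; _∧_; _∨_)
  open import Data.Nat.Base hiding (parity)
  open import Data.Nat.Properties
  open import Data.Product using (_×_; _,_; proj₁; proj₂)
  open import Data.Sum.Base using (inj₁; inj₂)
  open import Data.Vec.Base using (_∷_; replicate)
  open import Relation.Nullary
  open import Relation.Nullary.Decidable using (_×-dec_; dec-true; dec-false)
  open import Function.Base using (_∘_)
  open import Relation.Binary.PropositionalEquality
  open Transfer
  open Counting
  open Vandermonde using (topTrue)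
  open Chains
  open Bricks

  row-topTrue : ∀ b n f → (∀ i → i < n → f i ≡ true) → (∀ i → n ≤ i → i < n + b → f i ≡ false) →
                row f (n + b) ≡ topTrue b n
  row-topTrue b (suc n) f t≡ f≡ = cong₂ _∷_ (t≡ 0 z<s)
    (row-topTrue b n (f ∘ suc) (λ i i< → t≡ (suc i) (s<s i<)) (λ i n≤ i< → f≡ (suc i) (s≤s n≤) (s<s i<)))
  row-topTrue b zero f t≡ f≡ = row-false b f (λ i → f≡ i z≤n)
    where
    row-false : ∀ m f → (∀ i → i < m → f i ≡ false) → row f m ≡ replicate m false
    row-false zero    f f≡ = refl
    row-false (suc m) f f≡ = cong₂ _∷_ (f≡ 0 z<s) (row-false m (f ∘ suc) (λ i i< → f≡ (suc i) (s<s i<)))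

  bit-topTrue-true : ∀ b n i → i < n → bit (topTrue b n) i ≡ true
  bit-topTrue-true b (suc n) zero    _         = refl
  bit-topTrue-true b (suc n) (suc i) (s≤s i<n) = bit-topTrue-true b n i i<n

  bit-topTrue-false : ∀ b n i → n ≤ i → bit (topTrue b n) i ≡ false
  bit-topTrue-false b zero    i       _         = bit-false b i
    where
    bit-false : ∀ m i → bit (replicate m false) i ≡ false
    bit-false zero    i       = refl
    bit-false (suc m) zero    = refl
    bit-false (suc m) (suc i) = bit-false m i
  bit-topTrue-false b (suc n) (suc i) (s≤s n≤i) = bit-topTrue-false b n i n≤i

  dbl-+ : ∀ a b → dbl (a + b) ≡ a + (a + dbl b)
  dbl-+ zero    b = refl
  dbl-+ (suc a) b = cong suc (trans (cong suc (dbl-+ a b)) (sym (+-suc a (a + dbl b))))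

  module Encode (a b : ℕ) (B : Brick (a + dbl b) (dbl b) (dbl (a + b))) where
    open Brick B

    N lo hi : ℕ
    N  = a + dbl b
    lo = dbl b
    hi = dbl (a + b)

    -- The disjunct `N ≤ j` adds the lozenges of the completing triangle.
    V : ℕ → ℕ → Bool
    V i j = does (N ≤? j) ∨ w i j

    V-outer : ∀ {i j} → N ≤ j → V i j ≡ true
    V-outer {i} {j} p = cong (_∨ w i j) (dec-true (N ≤? j) p)

    V-inner : ∀ {i j} → j < N → V i j ≡ w i j
    V-inner {i} {j} p = cong (_∨ w i j) (dec-false (N ≤? j) (<⇒≱ p))

    lines : ℕ → ℕ → Bool
    lines t i = V i (t ∸ suc i)

    lines≡V : ∀ {t} i j → suc (i + j) ≡ t → lines t i ≡ V i j
    lines≡V i j refl = cong (V i) (m+n∸m≡n i j)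

    s-outer : ∀ i {j} → N ≤ j → s i j ≡ false
    s-outer zero        _   = s-zero _
    s-outer (suc i) {j} N≤j = ≢true λ eq → <⇒≱ (proj₂ (proj₁ (proj₁ (s-in i j eq)))) N≤j

    s-outerˡ : ∀ {i} j → N ≤ suc i → s (suc i) j ≡ false
    s-outerˡ {i} j N≤i = ≢true λ eq → <⇒≱ (proj₁ (proj₁ (proj₁ (s-in i j eq)))) N≤i

    i<N : ∀ {i j} → i ≤ j → i + j < hi → i < N
    i<N {i} {j} i≤j u = ≰⇒> λ N≤i → <⇒≱ (subst (i + j <_) (dbl-+ a b) u)
      (+-mono-≤ (≤-trans (m≤m+n a (dbl b)) N≤i) (≤-trans N≤i i≤j))

    rule : ∀ {i j} → i ≤ j → lo ≤ suc (i + j) → suc (i + j) < hi →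
           step ⟦ s i (suc j) ⟧ (V i (suc j)) (V i j) ≡ ⟦ s (suc i) j ⟧
    rule {i} {j} i≤j l u with N ≤? j
    ... | yes N≤j = step-One {b = false}
      (One-subst (V-outer {i} (m≤n⇒m≤1+n N≤j)) (s-outer i (m≤n⇒m≤1+n N≤j)) refl first)
      (One-subst (V-outer {i} N≤j) (s-outer (suc i) N≤j) refl first)
    ... | no N≰j = step-One {b = s (suc j) i} △-one
      (One-subst (V-inner (≰⇒> N≰j)) refl refl (cover▽ i j ((i<N i≤j (<⇒≤ u) , ≰⇒> N≰j) , l , u)))
      where
      △-one : One (V i (suc j)) (s i (suc j)) (s (suc j) i)
      △-one with N ≤? suc j
      -- The △ lies just outside the hexagon and the ▽ inside it, so no lozenge joins them.
      ... | yes N≤1+j = One-subst (V-outer {i} N≤1+j) (s-outer i N≤1+j) (s-outerˡ i N≤1+j) first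
      ... | no N≰1+j  = One-subst (V-inner (≰⇒> N≰1+j)) refl refl (cover△ i (suc j)
        ((i<N i≤j (<⇒≤ u) , ≰⇒> N≰1+j) , subst (lo ≤_) (sym (+-suc i j)) l , subst (_< hi) (sym (+-suc i j)) u))

    col : ℕ → ℕ → Carry
    col t = carry (lines (suc t)) (lines t)

    col≡s : ∀ {t} i j → i + j ≡ t → lo ≤ t → t < hi → i ≤ suc j → col t i ≡ ⟦ s i j ⟧
    col≡s zero    j eq   l u i≤ = cong ⟦_⟧ (sym (s-zero j))
    col≡s (suc i) j refl l u (s≤s i≤j) = begin
      step (col t i) (lines (suc t) i) (lines t i)
        ≡⟨ cong (λ c → step c (lines (suc t) i) (lines t i))
             (col≡s i (suc j) (+-suc i j) l u (m≤n⇒m≤1+n (m≤n⇒m≤1+n i≤j))) ⟩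
      step ⟦ s i (suc j) ⟧ (lines (suc t) i) (lines t i)
        ≡⟨ cong₂ (step ⟦ s i (suc j) ⟧) (lines≡V i (suc j) (cong suc (+-suc i j))) (lines≡V i j refl) ⟩
      step ⟦ s i (suc j) ⟧ (V i (suc j)) (V i j)
        ≡⟨ rule i≤j l u ⟩
      ⟦ s (suc i) j ⟧ ∎
      where
      open ≡-Reasoning
      t : ℕ
      t = suc (i + j)

    axis-down : ∀ {m} → m < a → Down N lo hi (m + b) (m + b)
    axis-down {m} m<a = (h<N , h<N) , subst (λ d → lo ≤ suc d) (dbl≡+ (m + b)) (m≤n⇒m≤1+n (dbl-mono (m≤n+m b m)))
      , subst (λ d → suc d < hi) (dbl≡+ (m + b)) (dbl-mono {suc (m + b)} (+-monoˡ-≤ b m<a))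
      where
      h<N : m + b < N
      h<N = +-mono-<-≤ m<a (subst (b ≤_) (sym (dbl≡+ b)) (m≤m+n b b))

    axis-s : ∀ {h} → s h h ≡ false
    axis-s {zero}  = s-zero 0
    axis-s {suc h} = ≢true λ eq →
      true≢false eq (proj₂ (One-diagonal (cover△ (suc h) (suc h) (proj₁ (s-in h (suc h) eq)))))

    dbl-range : ∀ {m} → m < a → lo ≤ dbl (m + b) × suc (dbl (m + b)) < hi
    dbl-range {m} m<a = dbl-mono (m≤n+m b m) , dbl-mono {suc (m + b)} (+-monoˡ-≤ b m<a)

    isLines : Lines b a lines
    isLines = record
      { bottom  = bottom
      ; middle  = λ {m} m<a → trans (lines≡V (m + b) (m + b) (cong suc (sym (dbl≡+ (m + b)))))
                   (trans (cong (does (N ≤? m + b) ∨_) (proj₁ (One-diagonal (cover▽ _ _ (axis-down m<a)))))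
                          (∨-true (does (N ≤? m + b))))
      ; evenCol = λ {m} m<a → trans (col≡s (m + b) (m + b) (sym (dbl≡+ (m + b)))
                     (proj₁ (dbl-range m<a)) (<⇒≤ (proj₂ (dbl-range m<a))) (n≤1+n _)) (cong ⟦_⟧ (axis-s {m + b}))
      ; oddCol  = λ {m} m<a → trans (col≡s (suc (m + b)) (m + b) (cong suc (sym (dbl≡+ (m + b))))
                     (m≤n⇒m≤1+n (proj₁ (dbl-range m<a))) (proj₂ (dbl-range m<a)) ≤-refl)
                   (cong ⟦_⟧ (proj₂ (One-diagonal (cover▽ _ _ (axis-down m<a)))))
      }
      where
      ∨-true : ∀ x → x ∨ true ≡ true
      ∨-true true  = refl
      ∨-true false = refl
      bottom : ∀ i → i < b → lines (dbl b) i ≡ false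
      bottom i i<b = begin
        lines lo i ≡⟨ lines≡V i j eq ⟩
        V i j      ≡⟨ V-inner (≤-trans (subst (j <_) eq (s≤s (m≤n+m j i))) (m≤n+m lo a)) ⟩
        w i j      ≡⟨ ≢true (λ p → <⇒≱ (≤-reflexive eq) (proj₁ (proj₂ (proj₁ (w-in i j p))))) ⟩
        false      ∎
        where
        open ≡-Reasoning
        j : ℕ
        j = lo ∸ suc i
        eq : suc (i + j) ≡ lo
        eq = m+[n∸m]≡n (≤-trans i<b (subst (b ≤_) (sym (dbl≡+ b)) (m≤m+n b b)))

    top-eq : ∀ {i} → i < a + b → suc (i + (hi ∸ suc i)) ≡ hi
    top-eq {i} i< = m+[n∸m]≡n (≤-trans i< (subst (a + b ≤_) (sym (dbl≡+ (a + b))) (m≤m+n (a + b) (a + b))))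

    top-true : ∀ i → i < a → lines hi i ≡ true
    top-true i i<a = V-outer {i} (+-cancelˡ-≤ (suc i) N j (≤-trans (+-monoˡ-≤ N i<a)
      (≤-reflexive (trans (sym (dbl-+ a b)) (sym (top-eq (≤-trans i<a (m≤m+n a b))))))))
      where
      j : ℕ
      j = hi ∸ suc i

    top-false : ∀ i → a ≤ i → i < a + b → lines hi i ≡ false
    top-false i a≤i i< = trans (V-inner {i} j<N)
      (≢true λ p → <-irrefl (top-eq i<) (proj₂ (proj₂ (proj₂ (w-in i j p)))))
      where
      j : ℕ
      j = hi ∸ suc i
      j<N : j < N
      j<N = +-cancelˡ-≤ a (suc j) N (begin
        a + suc j   ≤⟨ +-monoˡ-≤ (suc j) a≤i ⟩
        i + suc j   ≡⟨ +-suc i j ⟩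
        suc (i + j) ≡⟨ top-eq i< ⟩
        hi          ≡⟨ dbl-+ a b ⟩
        a + N       ∎)
        where open ≤-Reasoning

    word : row (lines hi) (a + b) ≡ topTrue b a
    word = row-topTrue b a (lines hi) top-true top-false

  -- Decoding inverts encoding. `R` is only asked to agree with the encoded lines on one side of the
  -- axis, because a chain remembers no more than that.
  module _ (a b : ℕ) (B : Brick (a + dbl b) (dbl b) (dbl (a + b))) {R : ℕ → ℕ → Bool} (L : Lines b a R)
           (tt : ∀ i → i < a → R (dbl (a + b)) i ≡ true)
           (tf : ∀ i → a ≤ i → i < a + b → R (dbl (a + b)) i ≡ false)
           (agree : Agree b a R (Encode.lines a b B)) where
    private
      module E = Encode a b B
      module D = Decode a b L tt tf
    open Brick B

    V≡w : ∀ {i j} → i ≤ j → Up E.N E.lo E.hi i j → D.V i j ≡ w i j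
    V≡w {i} {j} i≤j ((_ , j<) , (l , u)) =
      trans (agree (suc (i + j)) i (m≤n⇒m≤1+n l) u (s≤s (+-monoʳ-≤ i i≤j)))
      (trans (E.lines≡V i j refl) (E.V-inner j<))

    σ≡s : ∀ {i j} → i ≤ j → Up E.N E.lo E.hi i j → D.σ i j ≡ ⟦ s i j ⟧
    σ≡s {i} {j} i≤j (_ , (l , u)) =
      trans (carry-cong i (λ k k<i → agree (suc (i + j)) k (m≤n⇒m≤1+n l) u (m<n⇒m<1+n (below k<i)))
                          (λ k k<i → agree (i + j) k l (<⇒≤ u) (below k<i)))
            (E.col≡s i j refl l u (m≤n⇒m≤1+n i≤j))
      where
      below : ∀ {k} → k < i → k + k < i + j
      below k<i = +-mono-<-≤ k<i (≤-trans (<⇒≤ k<i) i≤j)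

    decode-w : ∀ i j → D.w i j ≡ w i j
    decode-w i j = bool-ext fwd bwd
      where
      raw : Up E.N E.lo E.hi i j → D.rawW i j ≡ w i j
      raw up with ≤-total i j
      ... | inj₁ i≤j = trans (D.rawW-≤ i≤j) (V≡w i≤j up)
      ... | inj₂ j≤i = trans (D.rawW-sym i j) (trans (D.rawW-≤ j≤i) (trans (V≡w j≤i (Up-swap i j up)) (w-sym j i)))
      fwd : D.w i j ≡ true → w i j ≡ true
      fwd eq with ((up , _) , r) ← guard-true (D.up? i j ×-dec D.down? i j) eq = trans (sym (raw up)) r
      bwd : w i j ≡ true → D.w i j ≡ true
      bwd eq = true-guard (D.up? i j ×-dec D.down? i j) (w-in i j eq) (trans (raw (proj₁ (w-in i j eq))) eq)

    decode-s : ∀ i j → D.s i j ≡ s i j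
    decode-s zero    j = sym (s-zero j)
    decode-s (suc i) j = bool-ext fwd bwd
      where
      raw : Up E.N E.lo E.hi (suc i) j → D.rawS (suc i) j ≡ s (suc i) j
      raw up with ≤-<-connex (suc i) j
      ... | inj₁ i<j = trans (D.rawS-≤ i<j) (trans (cong isSome (σ≡s i<j up)) (isSome-⟦⟧ _))
      ... | inj₂ j<i = trans (D.rawS-> j<i) (trans (cong₂ (λ v c → not v ∧ accept c) (V≡w (<⇒≤ j<i) up′) (σ≡s (<⇒≤ j<i) up′))
                         (One-third (cover△ j (suc i) up′)))
        where
        up′ : Up E.N E.lo E.hi j (suc i)
        up′ = Up-swap (suc i) j up
      fwd : D.s (suc i) j ≡ true → s (suc i) j ≡ true
      fwd eq with ((up , _) , r) ← guard-true (D.up? (suc i) j ×-dec D.down? i j) eq = trans (sym (raw up)) r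
      bwd : s (suc i) j ≡ true → D.s (suc i) j ≡ true
      bwd eq = true-guard (D.up? (suc i) j ×-dec D.down? i j) (s-in i j eq) (trans (raw (proj₁ (s-in i j eq))) eq)

  -- Encoding inverts decoding. Comparing `w` suffices, since the encoded lines are made from `w`
  -- alone.
  module _ (a b : ℕ) {R : ℕ → ℕ → Bool} (L : Lines b a R)
           (tt : ∀ i → i < a → R (dbl (a + b)) i ≡ true)
           (tf : ∀ i → a ≤ i → i < a + b → R (dbl (a + b)) i ≡ false)
           (B : Brick (a + dbl b) (dbl b) (dbl (a + b)))
           (B≡ : ∀ i j → Brick.w B i j ≡ Decode.w a b L tt tf i j) where
    private
      module D = Decode a b L tt tf
      module E = Encode a b B
    open E using (N; lo; hi)

    V≡R : ∀ {i j} → i ≤ j → lo ≤ suc (i + j) → suc (i + j) ≤ hi → E.V i j ≡ D.V i j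
    V≡R {i} {j} i≤j l u with N ≤? j
    ... | yes N≤j = trans (E.V-outer {i} N≤j) (sym (D.forced (hi ∸ suc (i + j)) (suc (i + j)) (m+[n∸m]≡n u) l i (s≤s (+-monoʳ-≤ i N≤j))))
    ... | no N≰j  = trans (E.V-inner (≰⇒> N≰j)) (trans (B≡ i j) (D.w≡V i≤j λ v → up v , D.V⇒down i≤j (up v) v))
      where
      up : D.V i j ≡ true → Up N lo hi i j
      up v with m≤n⇒m<n∨m≡n l
      ... | inj₁ (s≤s l′) = (E.i<N i≤j u , ≰⇒> N≰j) , (l′ , u)
      ... | inj₂ eq with () ← trans (sym v) (D.bottom-false i≤j (sym eq))

    encode-lines : Agree b a E.lines R
    encode-lines t i l u i< =
      trans (E.lines≡V i j t≡) (trans (V≡R i≤j (subst (lo ≤_) (sym t≡) l) (subst (_≤ hi) (sym t≡) u))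
                                      (cong (λ t → R t i) t≡))
      where
      j : ℕ
      j = t ∸ suc i
      t≡ : suc (i + j) ≡ t
      t≡ = m+[n∸m]≡n {suc i} {t} (≤-trans (s≤s (m≤m+n i i)) i<)
      i≤j : i ≤ j
      i≤j = +-cancelˡ-≤ i i j (≤-pred (subst (i + i <_) (sym t≡) i<))

-- Symmetric tilings as coverings in natural coordinates

module Geometry where

  open import Defs
  open import Data.Bool.Base using (Bool; true; false)
  open import Data.Nat.Base as ℕ using (ℕ; zero; suc; s≤s; z≤n)
  import Data.Nat.Properties as ℕₚ
  open import Data.Integer.Base as ℤ using (ℤ; +_; -[1+_]; -_; 0ℤ; 1ℤ; _+_; _-_; +≤+)
  import Data.Integer.Properties as ℤₚ
  open import Data.Integer.Tactic.RingSolver using (solve-∀)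
  open import Data.List.Relation.Unary.All using ([]; _∷_)
  open import Data.Product using (Σ; _×_; _,_; proj₁; proj₂; ∃!)
  open import Data.Sum.Base using (inj₁; inj₂)
  open import Data.Empty using (⊥; ⊥-elim)
  open import Function.Base using (_∘_; flip; case_of_)
  open import Relation.Binary.PropositionalEquality
  open Bricks using (Brick; One; first; second; third; One-subst; Up; Down; Up-swap; Down-swap; bool-ext; ≢true; true≢false)

  open Lozenge using (side)

  cancel-≤ : ∀ {x y} k → x + k ℤ.≤ y + k → x ℤ.≤ y
  cancel-≤ {x} {y} k p = subst₂ ℤ._≤_ (lemma x k) (lemma y k) (ℤₚ.+-monoˡ-≤ (- k) p)
    where
    lemma : ∀ x k → (x + k) + - k ≡ x
    lemma = solve-∀

  one-of : ∀ (m : Side → Bool) d → m d ≡ true → (∀ d′ → m d′ ≡ true → d ≡ d′) →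
           One (m e₂-e₁) (m e₂) (m e₁)
  one-of m e₂-e₁ eq uniq =
    One-subst eq (≢true λ p → case uniq e₂ p of λ ()) (≢true λ p → case uniq e₁ p of λ ()) first
  one-of m e₂ eq uniq =
    One-subst (≢true λ p → case uniq e₂-e₁ p of λ ()) eq (≢true λ p → case uniq e₁ p of λ ()) second
  one-of m e₁ eq uniq =
    One-subst (≢true λ p → case uniq e₂-e₁ p of λ ()) (≢true λ p → case uniq e₂ p of λ ()) eq third

  the-one : ∀ (m : Side → Bool) → One (m e₂-e₁) (m e₂) (m e₁) →
            Σ Side λ d → m d ≡ true × (∀ d′ → m d′ ≡ true → d ≡ d′)
  the-one m one with m e₂-e₁ in p | m e₂ in q | m e₁ in r
  the-one m first  | _ | _ | _ = e₂-e₁ , p , λ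
    { e₂-e₁ _ → refl ; e₂ x → ⊥-elim (true≢false x q) ; e₁ x → ⊥-elim (true≢false x r) }
  the-one m second | _ | _ | _ = e₂ , q , λ
    { e₂-e₁ x → ⊥-elim (true≢false x p) ; e₂ _ → refl ; e₁ x → ⊥-elim (true≢false x r) }
  the-one m third  | _ | _ | _ = e₁ , r , λ
    { e₂-e₁ x → ⊥-elim (true≢false x p) ; e₂ x → ⊥-elim (true≢false x q) ; e₁ _ → refl }

  -- nb d is the lozenge with side d among the three that contain t.
  module Around (t : Triangle) (nb : Side → Lozenge) (side-nb : ∀ d → side (nb d) ≡ d)
                (t∈nb : ∀ d → t ∈ˡ nb d) (only-nb : ∀ l → t ∈ˡ l → l ≡ nb (side l)) where

    one : ∀ (member : Lozenge → Bool) → ∃! _≡_ (λ l → member l ≡ true × t ∈ˡ l) →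
          One (member (nb e₂-e₁)) (member (nb e₂)) (member (nb e₁))
    one member (l , (l∈ , t∈l) , uniq) = one-of (member ∘ nb) (side l)
      (trans (cong member (sym (only-nb l t∈l))) l∈)
      (λ d p → trans (cong side (uniq (p , t∈nb d))) (side-nb d))

    unique : ∀ (member : Lozenge → Bool) → One (member (nb e₂-e₁)) (member (nb e₂)) (member (nb e₁)) →
             ∃! _≡_ (λ l → member l ≡ true × t ∈ˡ l)
    unique member one with (d , p , uniq) ← the-one (member ∘ nb) one =
      nb d , (p , t∈nb d) , λ {l} (l∈ , t∈l) →
        trans (cong nb (uniq (side l) (trans (cong member (sym (only-nb l t∈l))) l∈))) (sym (only-nb l t∈l))

  module Coordinates (a c hi : ℕ) (hi-sum : hi ≡ a ℕ.+ (a ℕ.+ c)) where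

    N : ℕ
    N = a ℕ.+ c

    -- In these coordinates the reflection swaps i and j.
    pt : ℕ → ℕ → Point
    pt i j = (+ i - + c , + j)

    x-suc : ∀ i → 1ℤ + (+ i - + c) ≡ + suc i - + c
    x-suc i = sym (ℤₚ.+-assoc 1ℤ (+ i) (- + c))

    x-pred : ∀ i → (+ suc i - + c) - 1ℤ ≡ + i - + c
    x-pred i = lemma (+ i) (+ c)
      where
      lemma : ∀ i c → ((1ℤ + i) - c) - 1ℤ ≡ i - c
      lemma = solve-∀

    x+c : ∀ i → (+ i - + c) + + c ≡ + i
    x+c i = lemma (+ i) (+ c)
      where
      lemma : ∀ i c → (i - c) + c ≡ i
      lemma = solve-∀

    x+c-c : ∀ x → (x + + c) - + c ≡ x
    x+c-c x = lemma x (+ c)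
      where
      lemma : ∀ x c → (x + c) - c ≡ x
      lemma = solve-∀

    Vertex : ℕ → ℕ → Set
    Vertex i j = (i ℕ.≤ N × j ℕ.≤ N) × (c ℕ.≤ i ℕ.+ j × i ℕ.+ j ℕ.≤ hi)

    sum+c : ∀ i j → ((+ i - + c) + + j) + + c ≡ + (i ℕ.+ j)
    sum+c i j = lemma (+ i) (+ j) (+ c)
      where
      lemma : ∀ i j c → ((i - c) + j) + c ≡ i + j
      lemma = solve-∀

    hi≡ : + (a ℕ.+ a) + + c ≡ + hi
    hi≡ = cong +_ (trans (ℕₚ.+-assoc a a c) (sym hi-sum))

    vertex⇒ : ∀ i j → InHexagon a a c (pt i j) → Vertex i j
    vertex⇒ i j ((_ , x≤a) , (_ , y≤) , (0≤s , s≤)) =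
      (ℤₚ.drop‿+≤+ (subst (ℤ._≤ + N) (x+c i) (ℤₚ.+-monoˡ-≤ (+ c) x≤a)) , ℤₚ.drop‿+≤+ y≤) ,
      (ℤₚ.drop‿+≤+ (subst (+ c ℤ.≤_) (sum+c i j) (ℤₚ.+-monoˡ-≤ (+ c) 0≤s)) ,
       ℤₚ.drop‿+≤+ (subst₂ ℤ._≤_ (sum+c i j) hi≡ (ℤₚ.+-monoˡ-≤ (+ c) s≤)))

    ⇒vertex : ∀ i j → Vertex i j → InHexagon a a c (pt i j)
    ⇒vertex i j ((i≤ , j≤) , (l , u)) =
      (cancel-≤ (+ c) (subst₂ ℤ._≤_ (sym (ℤₚ.+-inverseˡ (+ c))) (sym (x+c i)) (+≤+ z≤n)) ,
       cancel-≤ (+ c) (subst (ℤ._≤ + N) (sym (x+c i)) (+≤+ i≤))) ,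
      (+≤+ z≤n , +≤+ j≤) ,
      (cancel-≤ (+ c) (subst (+ c ℤ.≤_) (sym (sum+c i j)) (+≤+ l)) ,
       cancel-≤ (+ c) (subst₂ ℤ._≤_ (sym (sum+c i j)) (sym hi≡) (+≤+ u)))

    H : Point → Set
    H = InHexagon a a c

    vertexˢ : ∀ i j → H (1ℤ + (+ i - + c) , + j) → Vertex (suc i) j
    vertexˢ i j p = vertex⇒ (suc i) j (subst (λ x → H (x , + j)) (x-suc i) p)

    ˢvertex : ∀ i j → Vertex (suc i) j → H (1ℤ + (+ i - + c) , + j)
    ˢvertex i j p = subst (λ x → H (x , + j)) (sym (x-suc i)) (⇒vertex (suc i) j p)

    △⇒up : ∀ i j → △ (pt i j) ⊆H[ a , a , c ] → Up N c hi i j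
    △⇒up i j (p ∷ q ∷ r ∷ []) with vertex⇒ i j p | vertexˢ i j q | vertex⇒ i (suc j) r
    ... | _ , (l , _) | (i< , _) , (_ , u) | (_ , j<) , _ = (i< , j<) , (l , u)

    up⇒△ : ∀ i j → Up N c hi i j → △ (pt i j) ⊆H[ a , a , c ]
    up⇒△ i j ((i< , j<) , (l , u)) =
      ⇒vertex i j ((ℕₚ.<⇒≤ i< , ℕₚ.<⇒≤ j<) , (l , ℕₚ.<⇒≤ u)) ∷
      ˢvertex i j ((i< , ℕₚ.<⇒≤ j<) , (ℕₚ.m≤n⇒m≤1+n l , u)) ∷
      ⇒vertex i (suc j) ((ℕₚ.<⇒≤ i< , j<) , (ℕₚ.≤-trans l (ℕₚ.+-monoʳ-≤ i (ℕₚ.n≤1+n j)) ,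
        subst (ℕ._≤ hi) (sym (ℕₚ.+-suc i j)) u)) ∷ []

    ▽⇒down : ∀ i j → ▽ (pt i j) ⊆H[ a , a , c ] → Down N c hi i j
    ▽⇒down i j (p ∷ q ∷ r ∷ []) with vertexˢ i j p | vertexˢ i (suc j) r
    ... | _ , (l , _) | (i< , j<) , (_ , u) = (i< , j<) , (l , subst (ℕ._≤ hi) (ℕₚ.+-suc (suc i) j) u)

    down⇒▽ : ∀ i j → Down N c hi i j → ▽ (pt i j) ⊆H[ a , a , c ]
    down⇒▽ i j ((i< , j<) , (l , u)) =
      ˢvertex i j ((i< , ℕₚ.<⇒≤ j<) , (l , ℕₚ.<⇒≤ u)) ∷
      ⇒vertex i (suc j) ((ℕₚ.<⇒≤ i< , j<) , (subst (c ℕ.≤_) (sym (ℕₚ.+-suc i j)) l ,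
        subst (ℕ._≤ hi) (sym (ℕₚ.+-suc i j)) (ℕₚ.<⇒≤ u))) ∷
      ˢvertex i (suc j) ((i< , j<) , (ℕₚ.≤-trans l (s≤s (ℕₚ.+-monoʳ-≤ i (ℕₚ.n≤1+n j))) ,
        subst (ℕ._≤ hi) (sym (ℕₚ.+-suc (suc i) j)) u)) ∷ []

    IsPt : Point → Set
    IsPt p = Σ ℕ λ i → Σ ℕ λ j → p ≡ pt i j

    nonneg : ∀ {x} → 0ℤ ℤ.≤ x → Σ ℕ λ n → x ≡ + n
    nonneg (+≤+ {n = n} _) = n , refl

    isPt : ∀ {x y} → - (+ c) ℤ.≤ x → 0ℤ ℤ.≤ y → IsPt (x , y)
    isPt {x} {y} -c≤x 0≤y
      with (i , eq) ← nonneg (subst (ℤ._≤ x + + c) (ℤₚ.+-inverseˡ (+ c)) (ℤₚ.+-monoˡ-≤ (+ c) -c≤x))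
      with (j , refl) ← nonneg 0≤y
      = i , j , cong (_, + j) (trans (sym (x+c-c x)) (cong (_- + c) eq))

    △-isPt : ∀ {p} → △ p ⊆H[ a , a , c ] → IsPt p
    △-isPt (((-c≤x , _) , (0≤y , _) , _) ∷ _) = isPt -c≤x 0≤y

    -- `p` is not a corner of `▽ p`, so the two lower bounds come from different corners.
    ▽-isPt : ∀ {p} → ▽ p ⊆H[ a , a , c ] → IsPt p
    ▽-isPt ((_ , (0≤y , _) , _) ∷ ((-c≤x , _) , _) ∷ _) = isPt -c≤x 0≤y

    around△ around▽ : ℕ → ℕ → Side → Lozenge
    around△ i j d     = lozenge (pt i j) d
    around▽ i j e₂-e₁ = lozenge (pt i j) e₂-e₁
    around▽ i j e₂    = lozenge (pt (suc i) j) e₂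
    around▽ i j e₁    = lozenge (pt i (suc j)) e₁

    only△ : ∀ i j l → △ (pt i j) ∈ˡ l → l ≡ around△ i j (side l)
    only△ i j (lozenge _ _)     (inj₁ refl) = refl
    only△ i j (lozenge _ e₁)    (inj₂ ())
    only△ i j (lozenge _ e₂)    (inj₂ ())
    only△ i j (lozenge _ e₂-e₁) (inj₂ ())

    side-around▽ : ∀ i j d → side (around▽ i j d) ≡ d
    side-around▽ i j e₂-e₁ = refl
    side-around▽ i j e₂    = refl
    side-around▽ i j e₁    = refl

    ▽∈around▽ : ∀ i j d → ▽ (pt i j) ∈ˡ around▽ i j d
    ▽∈around▽ i j e₂-e₁ = inj₂ refl
    ▽∈around▽ i j e₂    = inj₂ (cong (λ x → ▽ (x , + j)) (sym (x-pred i)))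
    ▽∈around▽ i j e₁    = inj₂ refl

    add-one : ∀ y → (1ℤ + (y - 1ℤ)) ≡ y
    add-one = solve-∀

    only▽ : ∀ i j l → ▽ (pt i j) ∈ˡ l → l ≡ around▽ i j (side l)
    only▽ i j l (inj₁ ())
    only▽ i j (lozenge (x , y) e₂-e₁) (inj₂ refl) = refl
    -- Once `x - 1ℤ` is abstracted the equation of triangles can be matched; `x` is recovered by
    -- adding one.
    only▽ i j (lozenge (x , y) e₂)    (inj₂ eq) with x - 1ℤ in x≡
    only▽ i j (lozenge (x , y) e₂)    (inj₂ refl) | _ =
      cong (λ x → lozenge (x , y) e₂) (trans (sym (add-one x)) (trans (cong (λ z → 1ℤ + z) x≡) (x-suc i)))
    only▽ i j (lozenge (x , y) e₁)    (inj₂ eq) with y - 1ℤ in y≡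
    only▽ i j (lozenge (x , y) e₁)    (inj₂ refl) | _ =
      cong (λ y → lozenge (x , y) e₁) (trans (sym (add-one y)) (cong (λ z → 1ℤ + z) y≡))

    module Around△ (i j : ℕ) = Around (△ (pt i j)) (around△ i j) (λ _ → refl) (λ _ → inj₁ refl) (only△ i j)
    module Around▽ (i j : ℕ) = Around (▽ (pt i j)) (around▽ i j) (side-around▽ i j) (▽∈around▽ i j) (only▽ i j)

    member-sides : (w s : ℕ → ℕ → Bool) → Side → ℕ → ℕ → Bool
    member-sides w s e₂-e₁ = w
    member-sides w s e₂    = s
    member-sides w s e₁    = flip s

    module FromTiling (T : Tiling a a c) (T-sym : Symmetric T) where
      open Tiling T

      w s : ℕ → ℕ → Bool
      w i j = member (lozenge (pt i j) e₂-e₁)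
      s i j = member (lozenge (pt i j) e₂)

      reflectPoint-pt : ∀ i j → reflectPoint c (pt i j) ≡ pt j i
      reflectPoint-pt i j = cong (+ j - + c ,_) (x+c i)

      e₁≡ : ∀ i j → member (lozenge (pt i j) e₁) ≡ s j i
      e₁≡ i j = trans (cong (λ p → member (lozenge p e₁)) (sym (reflectPoint-pt j i))) (T-sym (lozenge (pt j i) e₂))

      member≡ : ∀ d i j → member-sides w s d i j ≡ member (lozenge (pt i j) d)
      member≡ e₂-e₁ i j = refl
      member≡ e₂    i j = refl
      member≡ e₁    i j = sym (e₁≡ i j)

      s-in : ∀ i j → s (suc i) j ≡ true → Up N c hi (suc i) j × Down N c hi i j
      s-in i j eq with (△∈ , ▽∈) ← contained (lozenge (pt (suc i) j) e₂) eq =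
        △⇒up (suc i) j △∈ , ▽⇒down i j (subst (λ x → ▽ (x , + j) ⊆H[ a , a , c ]) (x-pred i) ▽∈)

      s-zero : ∀ j → s 0 j ≡ false
      s-zero j = ≢true λ eq → absurd (▽-isPt (proj₂ (contained (lozenge (pt 0 j) e₂) eq)))
        where
        lemma : ∀ i c → i ≡ ((i - c) - (0ℤ - c - 1ℤ)) + - 1ℤ
        lemma = solve-∀
        absurd : IsPt ((0ℤ - + c) - 1ℤ , + j) → ⊥
        -- The ▽ would have first coordinate -c - 1, that is, i = -1.
        absurd (i , _ , eq) with () ← trans (lemma (+ i) (+ c))
          (cong (_+ - 1ℤ) (trans (cong (λ p → (+ i - + c) - proj₁ p) eq) (ℤₚ.+-inverseʳ (+ i - + c))))

      brick : Brick N c hi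
      brick = record
        { w = w ; s = s
        ; w-sym = λ i j → trans (sym (T-sym (lozenge (pt i j) e₂-e₁))) (cong (λ p → member (lozenge p e₂-e₁)) (reflectPoint-pt i j))
        ; w-in = λ i j eq → let (△∈ , ▽∈) = contained (lozenge (pt i j) e₂-e₁) eq in △⇒up i j △∈ , ▽⇒down i j ▽∈
        ; s-zero = s-zero
        ; s-in = s-in
        ; cover△ = λ i j up → One-subst refl refl (sym (e₁≡ i j))
            (Around△.one i j member (covered (△ (pt i j)) (up⇒△ i j up)))
        ; cover▽ = λ i j dn → One-subst refl refl (sym (e₁≡ i (suc j)))
            (Around▽.one i j member (covered (▽ (pt i j)) (down⇒▽ i j dn)))
        }

    -- A negative coordinate puts the △ of the lozenge outside the hexagon, hence the value `false`.
    get : (ℕ → ℕ → Bool) → ℤ → ℤ → Bool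
    get f (+ i)    (+ j)    = f i j
    get f (+ i)    -[1+ j ] = false
    get f -[1+ i ] y        = false

    get-true : ∀ f x y → get f x y ≡ true → Σ ℕ λ i → Σ ℕ λ j → x ≡ + i × y ≡ + j × f i j ≡ true
    get-true f (+ i) (+ j) eq = i , j , refl , refl , eq

    get-flip : ∀ f g → (∀ i j → f i j ≡ g j i) → ∀ x y → get f x y ≡ get g y x
    get-flip f g eq (+ i)    (+ j)    = eq i j
    get-flip f g eq (+ i)    -[1+ j ] = refl
    get-flip f g eq -[1+ i ] (+ j)    = refl
    get-flip f g eq -[1+ i ] -[1+ j ] = refl

    module ToTiling (B : Brick N c hi) where
      open Brick B

      member : Lozenge → Bool
      member (lozenge (x , y) d) = get (member-sides w s d) (x + + c) y

      member-pt : ∀ d i j → member (lozenge (pt i j) d) ≡ member-sides w s d i j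
      member-pt d i j = cong (λ x → get (member-sides w s d) x (+ j)) (x+c i)

      member-true : ∀ p d → member (lozenge p d) ≡ true →
                    Σ ℕ λ i → Σ ℕ λ j → p ≡ pt i j × member-sides w s d i j ≡ true
      member-true (x , y) d eq with (i , j , x≡ , y≡ , f≡) ← get-true (member-sides w s d) (x + + c) y eq =
        i , j , cong₂ _,_ (trans (sym (x+c-c x)) (cong (_- + c) x≡)) y≡ , f≡

      contained-pt : ∀ d i j → member-sides w s d i j ≡ true →
        △-half (lozenge (pt i j) d) ⊆H[ a , a , c ] × ▽-half (lozenge (pt i j) d) ⊆H[ a , a , c ]
      contained-pt e₂-e₁ i       j eq with (up , dn) ← w-in i j eq = up⇒△ i j up , down⇒▽ i j dn
      contained-pt e₂    zero    j eq = ⊥-elim (true≢false eq (s-zero j))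
      contained-pt e₂    (suc i) j eq with (up , dn) ← s-in i j eq =
        up⇒△ (suc i) j up , subst (λ x → ▽ (x , + j) ⊆H[ a , a , c ]) (sym (x-pred i)) (down⇒▽ i j dn)
      contained-pt e₁    i zero    eq = ⊥-elim (true≢false eq (s-zero i))
      contained-pt e₁    i (suc j) eq with (up , dn) ← s-in j i eq =
        up⇒△ i (suc j) (Up-swap (suc j) i up) , down⇒▽ i j (Down-swap j i dn)

      covered : ∀ t → t ⊆H[ a , a , c ] → ∃! _≡_ (λ l → member l ≡ true × t ∈ˡ l)
      covered (△ p) t∈ with (i , j , refl) ← △-isPt t∈ = Around△.unique i j member
        (One-subst (member-pt e₂-e₁ i j) (member-pt e₂ i j) (member-pt e₁ i j) (cover△ i j (△⇒up i j t∈)))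
      covered (▽ p) t∈ with (i , j , refl) ← ▽-isPt t∈ = Around▽.unique i j member
        (One-subst (member-pt e₂-e₁ i j) (member-pt e₂ (suc i) j) (member-pt e₁ i (suc j)) (cover▽ i j (▽⇒down i j t∈)))

      tiling : Tiling a a c
      tiling = record
        { member    = member
        ; contained = contained
        ; covered   = covered
        }
        where
        contained : ∀ l → member l ≡ true → △-half l ⊆H[ a , a , c ] × ▽-half l ⊆H[ a , a , c ]
        contained (lozenge p d) eq with (i , j , refl , f≡) ← member-true p d eq = contained-pt d i j f≡

      symmetric : Symmetric tiling
      symmetric (lozenge (x , y) d) =
        trans (cong (λ z → get (member-sides w s (reflectSide d)) z (x + + c)) (lemma y (+ c)))
              (get-flip (member-sides w s (reflectSide d)) (member-sides w s d) (flipped d) y (x + + c))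
        where
        lemma : ∀ y c → (y - c) + c ≡ y
        lemma = solve-∀
        flipped : ∀ d i j → member-sides w s (reflectSide d) i j ≡ member-sides w s d j i
        flipped e₂-e₁ = w-sym
        flipped e₂    i j = refl
        flipped e₁    i j = refl

    module _ (T : Tiling a a c) (T-sym : Symmetric T) (B : Brick N c hi)
             (B-w : ∀ i j → Brick.w B i j ≡ FromTiling.w T T-sym i j)
             (B-s : ∀ i j → Brick.s B i j ≡ FromTiling.s T T-sym i j) where
      open Tiling T

      sides≡ : ∀ d i j → member-sides (Brick.w B) (Brick.s B) d i j ≡ member (lozenge (pt i j) d)
      sides≡ d i j = trans (eq d) (FromTiling.member≡ T T-sym d i j)
        where
        eq : ∀ d → member-sides (Brick.w B) (Brick.s B) d i j
                   ≡ member-sides (FromTiling.w T T-sym) (FromTiling.s T T-sym) d i j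
        eq e₂-e₁ = B-w i j
        eq e₂    = B-s i j
        eq e₁    = B-s j i

      tiling-of-brick : ∀ l → ToTiling.member B l ≡ member l
      tiling-of-brick (lozenge p d) = bool-ext fwd bwd
        where
        fwd : ToTiling.member B (lozenge p d) ≡ true → member (lozenge p d) ≡ true
        fwd eq with (i , j , refl , f≡) ← ToTiling.member-true B p d eq = trans (sym (sides≡ d i j)) f≡
        bwd : member (lozenge p d) ≡ true → ToTiling.member B (lozenge p d) ≡ true
        bwd eq with (i , j , refl) ← △-isPt (proj₁ (contained (lozenge p d) eq)) =
          trans (ToTiling.member-pt B d i j) (trans (sides≡ d i j) eq)

-- The bijection between chains and symmetric tilings

module Correspondence where

  open import Defs
  open import Data.Bool.Base using (true; false; _∨_)
  open import Data.Nat.Base hiding (parity)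
  open import Data.Nat.Properties
  open import Data.Product using (Σ; _,_; proj₁)
  open import Relation.Nullary using (does)
  open import Function.Bundles using (Inverse)
  open import Function.Construct.Composition using (inverse)
  open import Function.Construct.Symmetry using (↔-sym)
  open import Relation.Binary.PropositionalEquality
  open Counting using (count)
  open Vandermonde using (topTrue)
  open Chains
  open Bricks
  open Encoding
  open Geometry

  module Bijection (a b : ℕ) where
    open Coordinates a (dbl b) (dbl (a + b)) (dbl-+ a b)

    Tilings : Set
    Tilings = Σ (Tiling a a (dbl b)) Symmetric

    TopChain : Set
    TopChain = Chain b a (topTrue b a)

    bits-cast : ∀ {v u} (eq : v ≡ u) (x : Chain b a v) → bits (subst (Chain b a) eq x) ≡ bits x
    bits-cast refl x = refl

    abstract
      -- All that matters about this chain is that its bits agree with the encoded lines, so the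
      -- construction is sealed off.
      chain : Brick N (dbl b) (dbl (a + b)) → TopChain
      chain B = subst (Chain b a) word (build a isLines)
        where open Encode a b B

      chain-bits : ∀ B → Agree b a (bits (chain B)) (Encode.lines a b B)
      chain-bits B t i l u i< =
        trans (cong (λ R → R t i) (bits-cast word (build a isLines))) (bits-build a isLines t i l u i<)
        where open Encode a b B

    chain-injective : ∀ (x y : TopChain) → Agree b a (bits x) (bits y) → x ≡ y
    chain-injective x y eq with refl ← bits-injective x y eq = refl

    top-true : ∀ (x : TopChain) i → i < a → bits x (dbl (a + b)) i ≡ true
    top-true x i i<a = trans (bits-top x i) (bit-topTrue-true b a i i<a)

    top-false : ∀ (x : TopChain) i → a ≤ i → i < a + b → bits x (dbl (a + b)) i ≡ false
    top-false x i a≤i _ = trans (bits-top x i) (bit-topTrue-false b a i a≤i)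

    brick : TopChain → Brick N (dbl b) (dbl (a + b))
    brick x = Decode.brick a b (bits-lines x) (top-true x) (top-false x)

    toTiling : TopChain → Tilings
    toTiling x = ToTiling.tiling (brick x) , ToTiling.symmetric (brick x)

    toBrick : Tilings → Brick N (dbl b) (dbl (a + b))
    toBrick (T , T-sym) = FromTiling.brick T T-sym

    toChain : Tilings → TopChain
    toChain T = chain (toBrick T)

    toTiling-toChain : ∀ T l → Tiling.member (proj₁ (toTiling (toChain T))) l ≡ Tiling.member (proj₁ T) l
    toTiling-toChain (T , T-sym) = tiling-of-brick T T-sym (brick x)
      (decode-w a b B (bits-lines x) (top-true x) (top-false x) (chain-bits B))
      (decode-s a b B (bits-lines x) (top-true x) (top-false x) (chain-bits B))
      where
      B : Brick N (dbl b) (dbl (a + b))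
      B = toBrick (T , T-sym)
      x : TopChain
      x = chain B

    toChain-toTiling : ∀ x → toChain (toTiling x) ≡ x
    toChain-toTiling x = chain-injective (toChain (toTiling x)) x λ t i l u i< →
      trans (chain-bits B t i l u i<)
            (encode-lines a b (bits-lines x) (top-true x) (top-false x) B
               (λ i j → ToTiling.member-pt (brick x) e₂-e₁ i j) t i l u i<)
      where
      B : Brick N (dbl b) (dbl (a + b))
      B = toBrick (toTiling x)

    -- Tilings are compared lozenge by lozenge, chains by propositional equality; `chain-injective`
    -- bridges the two.
    toChain-cong : ∀ T S → (∀ l → Tiling.member (proj₁ T) l ≡ Tiling.member (proj₁ S) l) → toChain T ≡ toChain S
    toChain-cong T S eq = chain-injective (toChain T) (toChain S) λ t i l u i< →
      trans (chain-bits (toBrick T) t i l u i<)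
      (trans (cong (does (N ≤? t ∸ suc i) ∨_) (eq (lozenge (pt i (t ∸ suc i)) e₂-e₁)))
             (sym (chain-bits (toBrick S) t i l u i<)))

    chain↔tilings : Inverse (setoid TopChain) (SymmetricTilings a (dbl b))
    chain↔tilings = record
      { to        = toTiling
      ; from      = toChain
      ; to-cong   = λ { refl _ → refl }
      ; from-cong = λ {T} {S} → toChain-cong T S
      ; inverse   = (λ {T} {x} eq l → trans (cong (λ y → Tiling.member (proj₁ (toTiling y)) l) eq) (toTiling-toChain T l))
                  , (λ {x} {T} eq → trans (toChain-cong T (toTiling x) eq) (toChain-toTiling x))
      }

  cardinality : ∀ a b → HasCardinality (SymmetricTilings a (2 * b)) (count b a (topTrue b a))
  cardinality a b = subst (λ c → HasCardinality (SymmetricTilings a c) (count b a (topTrue b a))) dbl≡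
    (inverse (↔-sym (Chain↔ b a (topTrue b a))) (Bijection.chain↔tilings a b))
    where
    dbl≡ : dbl b ≡ 2 * b
    dbl≡ = trans (dbl≡+ b) (cong (λ z → b + z) (sym (+-identityʳ b)))

open import Defs
open import Data.Nat.Base using (ℕ; _*_; _≤_)
open import Data.Integer.Base using (+_)
open import Data.Rational.Base using (_/_)
open import Data.Product using (∃-syntax; _×_; _,_)
open import Relation.Binary.PropositionalEquality using (_≡_)

open Counting using (count)
open Vandermonde using (topTrue)
open ProductFormula using (count≡productFormula)
open Correspondence using (cardinality)

theorem6p1 : ∀ (a b : ℕ) → 1 ≤ a → 1 ≤ b →
    ∃[ TC ] (HasCardinality (SymmetricTilings a (2 * b)) TC × + TC / 1 ≡ productFormula a b)
theorem6p1 a b _ _ = count b a (topTrue b a) , cardinality a b , count≡productFormula a b
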